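{- The set of (Gödel numbers of) unsatisfiable sentences over the universal fragment of Presburger arithmetic with additional uninterpreted predicate symbols is $\Sigma^0_1$-complete.
   Context: Presburger arithmetic comprises all first-order formulas with equality over the signature $\langle 0,1,+\rangle$, interpreted over the natural numbers $\mathbb{N}=\{0,1,2,\ldots\}$ with the standard meaning of $0,1,+$. Abbreviations: $s\le t$ is $\exists z.\, s+z=t$; $s<t$ is $s+1\le t$. The language is extended by uninterpreted predicate symbols (of arbitrary, not necessarily unary, arities), but by no uninterpreted constant or function symbols. The universal fragment consists of the sentences in prenex normal form in which only universal quantifiers occur; the abbreviations $s\le t$ and $s<t$ are exempt from this restriction, i.e. they are treated as quantifier-free atoms. An interpretation has domain $\mathbb{N}$, interprets $0,1,+$ in the standard way, and interprets each uninterpreted predicate symbol of arity $r$ by an arbitrary subset of $\mathbb{N}^r$. A sentence is unsatisfiable if no such interpretation satisfies it. $\Sigma^0_1$ is the class of recursively enumerable sets in the arithmetical hierarchy, and completeness is with respect to computable many-one reductions. -}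

module Defs where

open import Axiom.ExcludedMiddle using (ExcludedMiddle) public
open import Data.Fin.Base using (Fin; toℕ)
open import Data.Nat.Base using (ℕ; zero; suc; _+_; _<_)
open import Data.Product.Base using (_×_; ∃; ∃-syntax)
open import Data.Sum.Base using (_⊎_)
open import Data.Vec.Base using (Vec; []; _∷_; lookup; map)
open import Function.Bundles using (_⇔_)
open import Level using (Level; 0ℓ) public
open import Relation.Binary.PropositionalEquality.Core using (_≡_)
open import Relation.Nullary.Negation.Core using (¬_)
open import Relation.Unary using (Pred)

private
  variable
    ℓ ℓ′ : Level
    m n r : ℕ

------------------------------------------------------------------------
-- Partial recursive functions

data Rec : ℕ → Set where
  zero : Rec 0
  succ : Rec 1
  proj : Fin n → Rec n
  comp : Rec m → Vec (Rec n) m → Rec n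
  prec : Rec n → Rec (suc (suc n)) → Rec (suc n)
  mu   : Rec (suc n) → Rec n

infix 4 _[_]⇓_

-- f [ xs ]⇓ y : the partial function f is defined at xs, with value y.

data _[_]⇓_ : Rec n → Vec ℕ n → ℕ → Set where
  zero⇓ : zero [ [] ]⇓ 0
  succ⇓ : ∀ {x} → succ [ x ∷ [] ]⇓ suc x
  proj⇓ : ∀ {i : Fin n} {xs} → proj i [ xs ]⇓ lookup xs i
  comp⇓ : ∀ {f : Rec m} {gs : Vec (Rec n) m} {xs ys z} →
          (∀ i → lookup gs i [ xs ]⇓ lookup ys i) →
          f [ ys ]⇓ z →
          comp f gs [ xs ]⇓ z
  prec⇓-zero : ∀ {f : Rec n} {g xs y} →
          f [ xs ]⇓ y →
          prec f g [ 0 ∷ xs ]⇓ y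
  prec⇓-suc : ∀ {f : Rec n} {g k xs y z} →
          prec f g [ k ∷ xs ]⇓ y →
          g [ k ∷ y ∷ xs ]⇓ z →
          prec f g [ suc k ∷ xs ]⇓ z
  mu⇓ : ∀ {f : Rec (suc n)} {k xs} →
          (∀ i → i < k → ∃[ v ] f [ i ∷ xs ]⇓ suc v) →
          f [ k ∷ xs ]⇓ 0 →
          mu f [ xs ]⇓ k

------------------------------------------------------------------------
-- Recursively enumerable sets and many-one completeness

Computable : (ℕ → ℕ) → Set
Computable f = ∃[ c ] (∀ x → c [ x ∷ [] ]⇓ f x)

-- The recursively enumerable sets are the domains of the partial
-- recursive functions.

Σ⁰₁ : Pred ℕ ℓ → Set ℓ
Σ⁰₁ A = ∃[ c ] (∀ x → A x ⇔ (∃[ y ] c [ x ∷ [] ]⇓ y))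

infix 4 _≤ₘ_

_≤ₘ_ : Pred ℕ ℓ → Pred ℕ ℓ′ → Set _
A ≤ₘ B = ∃[ f ] (Computable f × (∀ x → A x ⇔ B (f x)))

Σ⁰₁-Hard : Pred ℕ ℓ → Set (Level.suc ℓ)
Σ⁰₁-Hard {ℓ} B = (A : Pred ℕ ℓ) → Σ⁰₁ A → A ≤ₘ B

Σ⁰₁-Complete : Pred ℕ ℓ → Set (Level.suc ℓ)
Σ⁰₁-Complete B = Σ⁰₁ B × Σ⁰₁-Hard B

------------------------------------------------------------------------
-- Presburger arithmetic with uninterpreted predicate symbols

-- Variables are de Bruijn indices; n bounds the free variables.

data Term (n : ℕ) : Set where
  var  : Fin n → Term n
  `0   : Term n
  `1   : Term n
  _`+_ : Term n → Term n → Term n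

-- For every arity r there are countably many predicate symbols, and
-- pred i ts with ts : Vec (Term n) r applies the i-th one of arity r.
-- The abbreviations ≤ and < are atoms, so that they may occur in
-- quantifier-free formulas.

data Formula (n : ℕ) : Set where
  _`=_ : Term n → Term n → Formula n
  _`≤_ : Term n → Term n → Formula n
  _`<_ : Term n → Term n → Formula n
  pred : (i : ℕ) → Vec (Term n) r → Formula n
  `¬_  : Formula n → Formula n
  _`∧_ : Formula n → Formula n → Formula n
  _`∨_ : Formula n → Formula n → Formula n
  _`→_ : Formula n → Formula n → Formula n
  `∀_  : Formula (suc n) → Formula n
  `∃_  : Formula (suc n) → Formula n

Sentence : Set
Sentence = Formula 0

data QuantifierFree {n : ℕ} : Formula n → Set where
  qf-=    : ∀ {s t} → QuantifierFree (s `= t)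
  qf-≤    : ∀ {s t} → QuantifierFree (s `≤ t)
  qf-<    : ∀ {s t} → QuantifierFree (s `< t)
  qf-pred : ∀ {i} {ts : Vec (Term n) r} → QuantifierFree (pred i ts)
  qf-¬    : ∀ {φ} → QuantifierFree φ → QuantifierFree (`¬ φ)
  qf-∧    : ∀ {φ ψ} → QuantifierFree φ → QuantifierFree ψ → QuantifierFree (φ `∧ ψ)
  qf-∨    : ∀ {φ ψ} → QuantifierFree φ → QuantifierFree ψ → QuantifierFree (φ `∨ ψ)
  qf-→    : ∀ {φ ψ} → QuantifierFree φ → QuantifierFree ψ → QuantifierFree (φ `→ ψ)

data Universal {n : ℕ} : Formula n → Set where
  matrix : ∀ {φ} → QuantifierFree φ → Universal φ
  univ   : ∀ {φ} → Universal {suc n} φ → Universal (`∀ φ)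

------------------------------------------------------------------------
-- Semantics

-- The i-th predicate symbol of arity r denotes a subset of ℕʳ.

Interpretation : Set₁
Interpretation = (r i : ℕ) → Pred (Vec ℕ r) 0ℓ

⟦_⟧ : Term n → Vec ℕ n → ℕ
⟦ var x  ⟧ ρ = lookup ρ x
⟦ `0     ⟧ ρ = 0
⟦ `1     ⟧ ρ = 1
⟦ s `+ t ⟧ ρ = ⟦ s ⟧ ρ + ⟦ t ⟧ ρ

infix 4 _,_⊨_

_,_⊨_ : Interpretation → Vec ℕ n → Formula n → Set
I , ρ ⊨ (s `= t) = ⟦ s ⟧ ρ ≡ ⟦ t ⟧ ρ
I , ρ ⊨ (s `≤ t) = ∃[ z ] ⟦ s ⟧ ρ + z ≡ ⟦ t ⟧ ρ
I , ρ ⊨ (s `< t) = ∃[ z ] (⟦ s ⟧ ρ + 1) + z ≡ ⟦ t ⟧ ρ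
I , ρ ⊨ pred {r = r} i ts = I r i (map (λ t → ⟦ t ⟧ ρ) ts)
I , ρ ⊨ (`¬ φ)   = ¬ (I , ρ ⊨ φ)
I , ρ ⊨ (φ `∧ ψ) = (I , ρ ⊨ φ) × (I , ρ ⊨ ψ)
I , ρ ⊨ (φ `∨ ψ) = (I , ρ ⊨ φ) ⊎ (I , ρ ⊨ ψ)
I , ρ ⊨ (φ `→ ψ) = (I , ρ ⊨ φ) → (I , ρ ⊨ ψ)
I , ρ ⊨ (`∀ φ)   = ∀ (a : ℕ) → I , a ∷ ρ ⊨ φ
I , ρ ⊨ (`∃ φ)   = ∃[ a ] (I , a ∷ ρ ⊨ φ)

Unsatisfiable : Sentence → Set₁
Unsatisfiable φ = ¬ (∃[ I ] (I , [] ⊨ φ))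

------------------------------------------------------------------------
-- Gödel numbers

triangle : ℕ → ℕ
triangle zero    = 0
triangle (suc k) = suc k + triangle k

-- Cantor's bijection ℕ × ℕ → ℕ.

⟨_,_⟩ : ℕ → ℕ → ℕ
⟨ a , b ⟩ = triangle (a + b) + b

⌜_⌝ₜ : Term n → ℕ
⌜ var x  ⌝ₜ = ⟨ 0 , toℕ x ⟩
⌜ `0     ⌝ₜ = ⟨ 1 , 0 ⟩
⌜ `1     ⌝ₜ = ⟨ 2 , 0 ⟩
⌜ s `+ t ⌝ₜ = ⟨ 3 , ⟨ ⌜ s ⌝ₜ , ⌜ t ⌝ₜ ⟩ ⟩

-- The code of a vector determines its length, so the arity of a
-- predicate symbol need not be recorded separately in ⌜ pred i ts ⌝.

⌜_⌝ₜₛ : Vec (Term n) r → ℕ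
⌜ []     ⌝ₜₛ = 0
⌜ t ∷ ts ⌝ₜₛ = suc ⟨ ⌜ t ⌝ₜ , ⌜ ts ⌝ₜₛ ⟩

⌜_⌝ : Formula n → ℕ
⌜ s `= t    ⌝ = ⟨ 0 , ⟨ ⌜ s ⌝ₜ , ⌜ t ⌝ₜ ⟩ ⟩
⌜ s `≤ t    ⌝ = ⟨ 1 , ⟨ ⌜ s ⌝ₜ , ⌜ t ⌝ₜ ⟩ ⟩
⌜ s `< t    ⌝ = ⟨ 2 , ⟨ ⌜ s ⌝ₜ , ⌜ t ⌝ₜ ⟩ ⟩
⌜ pred i ts ⌝ = ⟨ 3 , ⟨ i , ⌜ ts ⌝ₜₛ ⟩ ⟩
⌜ `¬ φ      ⌝ = ⟨ 4 , ⌜ φ ⌝ ⟩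
⌜ φ `∧ ψ    ⌝ = ⟨ 5 , ⟨ ⌜ φ ⌝ , ⌜ ψ ⌝ ⟩ ⟩
⌜ φ `∨ ψ    ⌝ = ⟨ 6 , ⟨ ⌜ φ ⌝ , ⌜ ψ ⌝ ⟩ ⟩
⌜ φ `→ ψ    ⌝ = ⟨ 7 , ⟨ ⌜ φ ⌝ , ⌜ ψ ⌝ ⟩ ⟩
⌜ `∀ φ      ⌝ = ⟨ 8 , ⌜ φ ⌝ ⟩
⌜ `∃ φ      ⌝ = ⟨ 9 , ⌜ φ ⌝ ⟩

UnsatisfiableUniversal : Pred ℕ (Level.suc 0ℓ)
UnsatisfiableUniversal k =
  ∃[ φ ] (k ≡ ⌜ φ ⌝ × Universal {0} φ × Unsatisfiable φ)

{-# OPTIONS --safe #-}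
-- Membership: truth of a quantifier-free formula under a finite truth
-- assignment is computable on codes, and by compactness a universal sentence
-- is unsatisfiable iff, for some M, every assignment to the atoms with codes
-- below M falsifies one of the first M instances of its matrix; μ searches
-- for M. The standard interpretation of 0, 1, + makes ground arithmetic atoms
-- decidable, so that only the uninterpreted atoms need to be assigned.
--
-- Hardness: the graphs of the subprograms of a partial recursive function c
-- form the least model of finitely many Horn clauses, whose arithmetic only
-- needs 0 and x + 1. Hence these clauses together with ∀ y. ¬ c(x) = y are
-- unsatisfiable iff c halts on x.
module Submission where

open import Defs
open import Data.Bool.Base using (Bool; true; false; if_then_else_; not)
open import Data.Fin.Base using (Fin; zero; suc; toℕ; fromℕ<)
open import Data.Fin.Patterns using (0F; 1F; 2F; 3F; 4F; 5F)
open import Data.Fin.Properties using (toℕ<n; toℕ-fromℕ<; toℕ-injective)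
open import Data.Nat.Base hiding (pred)
open import Data.Nat.Induction using (<-wellFounded)
open import Data.Nat.Properties
open import Data.Product.Base using (_×_; _,_; proj₁; proj₂; ∃; ∃-syntax)
open import Data.Sum.Base using (_⊎_; inj₁; inj₂; [_,_])
open import Data.Vec.Base using (Vec; []; _∷_; _++_; drop; head; lookup; map; replicate; tabulate; tail; take)
open import Data.Vec.Properties
  using (drop-map; lookup-map; lookup∘tabulate; tabulate-cong; tabulate-∘; tabulate∘lookup; take-map)
open import Data.Vec.Relation.Unary.All using (All; []; _∷_)
import Data.Vec.Relation.Unary.All.Properties as All
open import Function.Base using (_∘_; id)
open import Function.Bundles using (_⇔_; mk⇔; Equivalence)
open import Induction.WellFounded using (Acc; acc)
open import Relation.Binary.Definitions using (tri<; tri≈; tri>)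
open import Relation.Binary.PropositionalEquality hiding ([_])
open import Relation.Nullary.Decidable.Core using (yes; no; does)
open import Relation.Nullary.Negation.Core using (¬_; contradiction)

private
  variable
    m n r : ℕ

-- A certificate is a number coding M, n and c: n and c guess how the sentence splits into
-- quantifiers and matrix, so the given number is only compared, never parsed. That c is the code of
-- a quantifier-free formula is read off the evaluation itself, which returns 0 on anything else;
-- this is why all operations on values are strict in 0. The single number M limits the atoms
-- assigned, the instances tried and, through them, the range of assignments that must fail. The
-- rule for `mu` is not Horn as it stands: its bounded universal premise is unwound by an auxiliary
-- predicate with recursive axioms. Predicate symbols are named by codes of programs, and the set in
-- question speaks of codes of sentences, hence both numberings must be injective. Excluded middle
-- picks the branches in the compactness argument, turns arbitrary subsets into bit sequences, and
-- passes from the impossibility of divergence to a halting computation.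

ifz : ℕ → ℕ → ℕ → ℕ
ifz zero    a b = a
ifz (suc _) a b = b

-- Cantor pairing

triangle-mono : m ≤ n → triangle m ≤ triangle n
triangle-mono z≤n       = z≤n
triangle-mono (s≤s m≤n) = +-mono-≤ (s≤s m≤n) (triangle-mono m≤n)

triangle-root-unique : ∀ {s t} → triangle s ≤ n → n < triangle (suc s) →
                       triangle t ≤ n → n < triangle (suc t) → s ≡ t
triangle-root-unique {s = s} {t} s≤ <s t≤ <t with <-cmp s t
... | tri< s<t _ _ = contradiction (<-≤-trans <s (≤-trans (triangle-mono s<t) t≤)) (<-irrefl refl)
... | tri≈ _ s≡t _ = s≡t
... | tri> _ _ t<s = contradiction (<-≤-trans <t (≤-trans (triangle-mono t<s) s≤)) (<-irrefl refl)

-- The largest s with `triangle s` at most n. The truncated difference is 0 exactly when `suc n` has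
-- reached the next triangular number.
root : ℕ → ℕ
root zero    = 0
root (suc n) = ifz (triangle (suc (root n)) ∸ suc n) (suc (root n)) (root n)

root-bounds : ∀ n → triangle (root n) ≤ n × n < triangle (suc (root n))
root-bounds zero    = z≤n , s≤s z≤n
root-bounds (suc n) with root-bounds n | triangle (suc (root n)) ∸ suc n in eq
... | _ , n< | zero  = m∸n≡0⇒m≤n eq , s≤s (≤-trans n< (m≤n+m _ (suc (root n))))
... | ≤n , _ | suc _ = m≤n⇒m≤1+n ≤n , m∸n≢0⇒n<m λ eq′ → 0≢1+n (trans (sym eq′) eq)

opaque

  π₁ π₂ : ℕ → ℕ
  π₂ n = n ∸ triangle (root n)
  π₁ n = root n ∸ π₂ n

  private
    root-⟨⟩ : ∀ a b → root ⟨ a , b ⟩ ≡ a + b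
    root-⟨⟩ a b = triangle-root-unique (proj₁ bounds) (proj₂ bounds) (m≤m+n _ b)
      (subst (_< triangle (suc (a + b))) (+-comm b _)
        (s≤s (+-monoˡ-≤ _ (m≤n+m b a))))
      where
      bounds : triangle (root ⟨ a , b ⟩) ≤ ⟨ a , b ⟩ × ⟨ a , b ⟩ < triangle (suc (root ⟨ a , b ⟩))
      bounds = root-bounds ⟨ a , b ⟩

  π₂-⟨⟩ : ∀ a b → π₂ ⟨ a , b ⟩ ≡ b
  π₂-⟨⟩ a b rewrite root-⟨⟩ a b = m+n∸m≡n (triangle (a + b)) b

  π₁-⟨⟩ : ∀ a b → π₁ ⟨ a , b ⟩ ≡ a
  π₁-⟨⟩ a b rewrite π₂-⟨⟩ a b | root-⟨⟩ a b = m+n∸n≡m a b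

  ⟨π₁,π₂⟩ : ∀ n → ⟨ π₁ n , π₂ n ⟩ ≡ n
  ⟨π₁,π₂⟩ n = begin
    triangle (root n ∸ π₂ n + π₂ n) + π₂ n ≡⟨ cong (λ s → triangle s + π₂ n) (m∸n+n≡m π₂≤root) ⟩
    triangle (root n) + π₂ n               ≡⟨ m+[n∸m]≡n (proj₁ (root-bounds n)) ⟩
    n                                      ∎
    where
    open ≡-Reasoning
    π₂≤root : π₂ n ≤ root n
    π₂≤root = m≤n+o⇒m∸n≤o n (triangle (root n))
      (≤-trans (s≤s⁻¹ (proj₂ (root-bounds n))) (≤-reflexive (+-comm (root n) _)))

  -- Gives the code 0 the tag 0, that of an atomic node, so its evaluation looks at no earlier
  -- value. This matters because no subcode of 0 is smaller than 0.
  π₁0≡0 : π₁ 0 ≡ 0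
  π₁0≡0 = refl

⟨⟩-injective : ∀ {a b c d} → ⟨ a , b ⟩ ≡ ⟨ c , d ⟩ → a ≡ c × b ≡ d
⟨⟩-injective {a} {b} {c} {d} eq =
  trans (sym (π₁-⟨⟩ a b)) (trans (cong π₁ eq) (π₁-⟨⟩ c d)) ,
  trans (sym (π₂-⟨⟩ a b)) (trans (cong π₂ eq) (π₂-⟨⟩ c d))

⟨⟩-mono-≤ : ∀ {a b c d} → a ≤ c → b ≤ d → ⟨ a , b ⟩ ≤ ⟨ c , d ⟩
⟨⟩-mono-≤ a≤c b≤d = +-mono-≤ (triangle-mono (+-mono-≤ a≤c b≤d)) b≤d

n≤triangle : ∀ n → n ≤ triangle n
n≤triangle zero    = z≤n
n≤triangle (suc n) = m≤m+n (suc n) _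

a≤⟨a,b⟩ : ∀ a b → a ≤ ⟨ a , b ⟩
a≤⟨a,b⟩ a b = ≤-trans (≤-trans (m≤m+n a b) (n≤triangle (a + b))) (m≤m+n _ b)

b≤⟨a,b⟩ : ∀ a b → b ≤ ⟨ a , b ⟩
b≤⟨a,b⟩ a b = m≤n+m b _

π₁≤ : ∀ n → π₁ n ≤ n
π₁≤ n = subst (π₁ n ≤_) (⟨π₁,π₂⟩ n) (a≤⟨a,b⟩ (π₁ n) (π₂ n))

π₂≤ : ∀ n → π₂ n ≤ n
π₂≤ n = subst (π₂ n ≤_) (⟨π₁,π₂⟩ n) (b≤⟨a,b⟩ (π₁ n) (π₂ n))

-- Only the pair of zeros has the code 0, so here the triangle adds at least 1 to the second
-- component. For `π₁` strictness fails, as ⟨ 1 , 0 ⟩ is 1; recursion on nodes therefore goes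
-- through the second component.
π₂< : ∀ n → π₂ (suc n) < suc n
π₂< n = subst (π₂ (suc n) <_) (⟨π₁,π₂⟩ (suc n)) (b<⟨a,b⟩ (π₁ (suc n)) (π₂ (suc n)) nonzero)
  where
  b<⟨a,b⟩ : ∀ a b → a + b ≢ 0 → b < ⟨ a , b ⟩
  b<⟨a,b⟩ a b a+b≢0 with a + b
  ... | zero  = contradiction refl a+b≢0
  ... | suc s = s≤s (m≤n+m b _)
  nonzero : π₁ (suc n) + π₂ (suc n) ≢ 0
  nonzero sum≡0 = contradiction (trans (sym (⟨π₁,π₂⟩ (suc n))) (zero-code (π₁ (suc n)) (π₂ (suc n)) sum≡0)) λ ()
    where
    zero-code : ∀ a b → a + b ≡ 0 → ⟨ a , b ⟩ ≡ 0
    zero-code zero zero _ = refl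

-- Lists as iterated pairs; the code 0 = ⟨ 0 , 0 ⟩ is an infinite list of zeros.

tails : ℕ → ℕ → ℕ
tails zero    h = h
tails (suc i) h = π₂ (tails i h)

at : ℕ → ℕ → ℕ
at h i = π₁ (tails i h)

tails-suc : ∀ i h → tails (suc i) h ≡ tails i (π₂ h)
tails-suc zero    h = refl
tails-suc (suc i) h = cong π₂ (tails-suc i h)

at-zero : ∀ a h → at ⟨ a , h ⟩ 0 ≡ a
at-zero a h = π₁-⟨⟩ a h

at-suc : ∀ a h i → at ⟨ a , h ⟩ (suc i) ≡ at h i
at-suc a h i = cong π₁ (trans (tails-suc i ⟨ a , h ⟩) (cong (tails i) (π₂-⟨⟩ a h)))

list : Vec ℕ n → ℕ
list []       = 0
list (x ∷ xs) = ⟨ x , list xs ⟩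

at-list : ∀ (xs : Vec ℕ n) i → at (list xs) (toℕ i) ≡ lookup xs i
at-list (x ∷ xs) zero    = at-zero x (list xs)
at-list (x ∷ xs) (suc i) = trans (at-suc x (list xs) (toℕ i)) (at-list xs i)

-- Total recursive functions

record Recursive (n : ℕ) (f : Vec ℕ n → ℕ) : Set where
  constructor _by_
  field
    code     : Rec n
    computes : ∀ xs → code [ xs ]⇓ f xs

open Recursive public

arg : ∀ i → Recursive n (λ xs → lookup xs i)
arg i = proj i by λ _ → proj⇓

codes : ∀ {fs : Vec (Vec ℕ n → ℕ) m} → All (Recursive n) fs → Vec (Rec n) m
codes []       = []
codes (c ∷ cs) = code c ∷ codes cs

-- For an explicit vector of functions the `map` reduces to the intended expression, so that a proof
-- of recursiveness simply mirrors the definition of its function.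
app : ∀ {f : Vec ℕ m → ℕ} {gs : Vec (Vec ℕ n → ℕ) m} → Recursive m f → All (Recursive n) gs →
      Recursive n (λ xs → f (map (λ g → g xs) gs))
app f gs = comp (code f) (codes gs) by λ xs → comp⇓ (computes* gs xs) (computes f _)
  where
  computes* : ∀ {fs : Vec (Vec ℕ n → ℕ) m} (cs : All (Recursive n) fs) xs i →
              lookup (codes cs) i [ xs ]⇓ lookup (map (λ g → g xs) fs) i
  computes* (c ∷ cs) xs zero    = computes c xs
  computes* (c ∷ cs) xs (suc i) = computes* cs xs i

args : ∀ (σ : Fin m → Fin n) → All (Recursive n) (tabulate (λ i xs → lookup xs (σ i)))
args σ = All.tabulate⁺ (λ i → arg (σ i))

-- With a variable number of parameters the tabulated projections do not reduce to the parameter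
-- vector by computation.
args-values : ∀ (σ : Fin m → Fin n) {xs ys} → (∀ i → lookup xs (σ i) ≡ lookup ys i) →
              map (λ g → g xs) (tabulate (λ i (zs : Vec ℕ n) → lookup zs (σ i))) ≡ ys
args-values σ {xs} {ys} eq = begin
  map (λ g → g xs) (tabulate (λ i zs → lookup zs (σ i))) ≡⟨ tabulate-∘ (λ g → g xs) _ ⟨
  tabulate (λ i → lookup xs (σ i))                       ≡⟨ tabulate-cong eq ⟩
  tabulate (lookup ys)                                   ≡⟨ tabulate∘lookup ys ⟩
  ys                                                     ∎
  where open ≡-Reasoning

respects : ∀ {f g : Vec ℕ n → ℕ} → (∀ xs → f xs ≡ g xs) → Recursive n f → Recursive n g
respects f≗g f = code f by λ xs → subst (code f [ xs ]⇓_) (f≗g xs) (computes f xs)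

-- A function defined elsewhere is recognised as primitive recursive by its two equations alone.
recursion : ∀ {z : Vec ℕ n → ℕ} {s : Vec ℕ (2 + n) → ℕ} {f : Vec ℕ (suc n) → ℕ} →
            Recursive n z → Recursive (2 + n) s →
            (∀ xs → f (0 ∷ xs) ≡ z xs) →
            (∀ i xs → f (suc i ∷ xs) ≡ s (i ∷ f (i ∷ xs) ∷ xs)) →
            Recursive (suc n) f
recursion {n = n} {f = f} z s f-zero f-suc = prec (code z) (code s) by λ { (i ∷ xs) → rec⇓ i xs }
  where
  rec⇓ : ∀ i (xs : Vec ℕ n) → prec (code z) (code s) [ i ∷ xs ]⇓ f (i ∷ xs)
  rec⇓ zero    xs = subst (_ [ _ ]⇓_) (sym (f-zero xs)) (prec⇓-zero (computes z xs))
  rec⇓ (suc i) xs = subst (_ [ _ ]⇓_) (sym (f-suc i xs)) (prec⇓-suc (rec⇓ i xs) (computes s _))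

suc-recursive : Recursive 1 (λ xs → suc (lookup xs 0F))
suc-recursive = succ by λ { (x ∷ []) → succ⇓ }

const : ∀ k → Recursive n (λ _ → k)
const zero    = comp zero [] by λ xs → comp⇓ {ys = []} (λ ()) zero⇓
const (suc k) = app suc-recursive (const k ∷ [])

pred-recursive : Recursive 1 (λ xs → lookup xs 0F ∸ 1)
pred-recursive = recursion (const 0) (arg 0F) (λ _ → refl) (λ _ _ → refl)

ifz-recursive : Recursive 3 (λ xs → ifz (lookup xs 0F) (lookup xs 1F) (lookup xs 2F))
ifz-recursive = recursion (arg 0F) (arg 3F) (λ _ → refl) (λ _ _ → refl)

+-recursive : Recursive 2 (λ xs → lookup xs 0F + lookup xs 1F)
+-recursive = recursion (arg 0F) (app suc-recursive (arg 1F ∷ [])) (λ _ → refl) (λ _ _ → refl)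

∸-recursive : Recursive 2 (λ xs → lookup xs 0F ∸ lookup xs 1F)
∸-recursive = app flipped (arg 1F ∷ arg 0F ∷ [])
  where
  -- `prec` recurses on its first argument, whereas the predecessor is iterated along the
  -- subtrahend.
  flipped : Recursive 2 (λ xs → lookup xs 1F ∸ lookup xs 0F)
  flipped = recursion (arg 0F) (app pred-recursive (arg 1F ∷ [])) (λ _ → refl)
    λ { i (x ∷ []) → sym (pred[m∸n]≡m∸[1+n] x i) }

triangle-recursive : Recursive 1 (λ xs → triangle (lookup xs 0F))
triangle-recursive = recursion (const 0)
  (app +-recursive (app suc-recursive (arg 0F ∷ []) ∷ arg 1F ∷ [])) (λ _ → refl) (λ _ _ → refl)

⟨⟩-recursive : Recursive 2 (λ xs → ⟨ lookup xs 0F , lookup xs 1F ⟩)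
⟨⟩-recursive = app +-recursive (app triangle-recursive (app +-recursive (arg 0F ∷ arg 1F ∷ []) ∷ []) ∷ arg 1F ∷ [])

root-recursive : Recursive 1 (λ xs → root (lookup xs 0F))
root-recursive = recursion (const 0)
  (app ifz-recursive
    (app ∸-recursive (app triangle-recursive (app suc-recursive (arg 1F ∷ []) ∷ []) ∷ app suc-recursive (arg 0F ∷ []) ∷ []) ∷
     app suc-recursive (arg 1F ∷ []) ∷ arg 1F ∷ []))
  (λ _ → refl) (λ _ _ → refl)

opaque
  unfolding π₁ π₂

  π₂-recursive : Recursive 1 (λ xs → π₂ (lookup xs 0F))
  π₂-recursive = app ∸-recursive (arg 0F ∷ app triangle-recursive (app root-recursive (arg 0F ∷ []) ∷ []) ∷ [])

  π₁-recursive : Recursive 1 (λ xs → π₁ (lookup xs 0F))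
  π₁-recursive = app ∸-recursive (app root-recursive (arg 0F ∷ []) ∷ app π₂-recursive (arg 0F ∷ []) ∷ [])

at-recursive : Recursive 2 (λ xs → at (lookup xs 0F) (lookup xs 1F))
at-recursive = app π₁-recursive (app tails-recursive (arg 1F ∷ arg 0F ∷ []) ∷ [])
  where
  tails-recursive : Recursive 2 (λ xs → tails (lookup xs 0F) (lookup xs 1F))
  tails-recursive = recursion (arg 0F) (app π₂-recursive (arg 1F ∷ [])) (λ _ → refl) (λ _ _ → refl)

-- The default 0 past the end makes unknown tags and impossible truth values count as ill-formed.
choose : Vec ℕ m → ℕ → ℕ
choose []       _       = 0
choose (a ∷ as) zero    = a
choose (a ∷ as) (suc i) = choose as i

choose-recursive : ∀ {fs : Vec (Vec ℕ n → ℕ) m} {g : Vec ℕ n → ℕ} → All (Recursive n) fs → Recursive n g →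
                   Recursive n (λ xs → choose (map (λ f → f xs) fs) (g xs))
choose-recursive []       g = const 0
choose-recursive {fs = f′ ∷ fs} {g = g′} (f ∷ fs-recursive) g =
  respects by-cases
    (app ifz-recursive (g ∷ f ∷ choose-recursive fs-recursive (app pred-recursive (g ∷ [])) ∷ []))
  where
  by-cases : ∀ xs → ifz (g′ xs) (f′ xs) (choose (map (λ f → f xs) fs) (g′ xs ∸ 1)) ≡
                    choose (map (λ f → f xs) (f′ ∷ fs)) (g′ xs)
  by-cases xs with g′ xs
  ... | zero  = refl
  ... | suc _ = refl

-- Plays the role of a bounded quantifier: the sum vanishes iff all its terms do.
∑< : ℕ → (ℕ → ℕ) → ℕ
∑< zero    f = 0
∑< (suc n) f = f n + ∑< n f

∑<-recursive : ∀ {f : Vec ℕ (suc n) → ℕ} → Recursive (suc n) f →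
               Recursive (suc n) (λ xs → ∑< (head xs) (λ i → f (i ∷ tail xs)))
∑<-recursive {f = f} f-recursive =
  recursion (const 0)
    (app +-recursive (app f-recursive (arg 0F ∷ args (λ i → suc (suc i))) ∷ arg 1F ∷ []))
    (λ _ → refl)
    (λ i xs → cong (λ ys → f (i ∷ ys) + ∑< i (λ j → f (j ∷ xs))) (sym (args-values (λ j → suc (suc j)) λ _ → refl)))

∑<≡0 : ∀ n {f} → (∀ i → i < n → f i ≡ 0) → ∑< n f ≡ 0
∑<≡0 zero    f≡0 = refl
∑<≡0 (suc n) f≡0 = cong₂ _+_ (f≡0 n ≤-refl) (∑<≡0 n λ i i<n → f≡0 i (m≤n⇒m≤1+n i<n))

∑<≡0⁻¹ : ∀ n {f} → ∑< n f ≡ 0 → ∀ i → i < n → f i ≡ 0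
∑<≡0⁻¹ (suc n) {f} eq i i<1+n with m≤n⇒m<n∨m≡n (s≤s⁻¹ i<1+n)
... | inj₁ i<n  = ∑<≡0⁻¹ n (m+n≡0⇒n≡0 (f n) eq) i i<n
... | inj₂ refl = m+n≡0⇒m≡0 _ eq

-- Course-of-values recursion: the second argument of G is the list of the
-- earlier values, latest first.

recall : ℕ → ℕ → ℕ → ℕ
recall n h j = at h (n ∸ suc j)

module CourseOfValues {p} (G : Vec ℕ (2 + p) → ℕ) where

  opaque

    history : ℕ → Vec ℕ p → ℕ
    history zero    ps = 0
    history (suc n) ps = ⟨ G (n ∷ history n ps ∷ ps) , history n ps ⟩

    fix : ℕ → Vec ℕ p → ℕ
    fix n ps = G (n ∷ history n ps ∷ ps)

    fix-unfold : ∀ n ps → fix n ps ≡ G (n ∷ history n ps ∷ ps)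
    fix-unfold n ps = refl

    -- The newest value is the head, and every later step pushes an entry one place down.
    recall-history : ∀ n ps {j} → j < n → recall n (history n ps) j ≡ fix j ps
    recall-history (suc n) ps {j} j<1+n with m≤n⇒m<n∨m≡n (s≤s⁻¹ j<1+n)
    ... | inj₂ refl rewrite n∸n≡0 n = at-zero (G (n ∷ history n ps ∷ ps)) (history n ps)
    ... | inj₁ j<n = begin
      at (history (suc n) ps) (n ∸ j)           ≡⟨ cong (at (history (suc n) ps)) (∸-suc j<n) ⟩
      at (history (suc n) ps) (suc (n ∸ suc j)) ≡⟨ at-suc (G (n ∷ history n ps ∷ ps)) (history n ps) (n ∸ suc j) ⟩
      at (history n ps) (n ∸ suc j)             ≡⟨ recall-history n ps j<n ⟩
      fix j ps                                  ∎
      where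
      open ≡-Reasoning
      ∸-suc : ∀ {m n} → m < n → n ∸ m ≡ suc (n ∸ suc m)
      ∸-suc {zero}  {suc n} _   = refl
      ∸-suc {suc m} {suc n} m<n = ∸-suc (s≤s⁻¹ m<n)

    fix-recursive : Recursive (2 + p) G → Recursive (suc p) (λ xs → fix (head xs) (tail xs))
    fix-recursive G-recursive =
      respects (λ { (n ∷ ps) → cong (λ qs → G (n ∷ history n ps ∷ qs)) (args-values suc (λ _ → refl)) })
        (app G-recursive (arg 0F ∷ history-recursive ∷ args suc))
      where
      history-recursive : Recursive (suc p) (λ xs → history (head xs) (tail xs))
      history-recursive = recursion (const 0) (app ⟨⟩-recursive (G-recursive ∷ arg 1F ∷ []))
        (λ _ → refl) (λ { i xs → refl })

-- Nodes of syntax trees: a tag paired with a body, which for a binary node pairs the two children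

tag body left right : ℕ → ℕ
tag c = π₁ c
body c = π₂ c
left c = π₁ (body c)
right c = π₂ (body c)

left< : ∀ c → left (suc c) < suc c
left< c = ≤-<-trans (π₁≤ (body (suc c))) (π₂< c)

right< : ∀ c → right (suc c) < suc c
right< c = ≤-<-trans (π₂≤ (body (suc c))) (π₂< c)

b<⟨1+a,b⟩ : ∀ a b → b < ⟨ suc a , b ⟩
b<⟨1+a,b⟩ a b = s≤s (m≤n+m b _)

recall-recursive : Recursive 3 (λ xs → recall (lookup xs 0F) (lookup xs 1F) (lookup xs 2F))
recall-recursive = app at-recursive (arg 1F ∷ app ∸-recursive (arg 0F ∷ app suc-recursive (arg 2F ∷ []) ∷ []) ∷ [])

left-recursive : Recursive 1 (λ xs → left (lookup xs 0F))
left-recursive = app π₁-recursive (app π₂-recursive (arg 0F ∷ []) ∷ [])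

right-recursive : Recursive 1 (λ xs → right (lookup xs 0F))
right-recursive = app π₂-recursive (app π₂-recursive (arg 0F ∷ []) ∷ [])

-- Evaluation of codes of terms over n variables, whose values are listed by e.
-- The result 0 stands for an ill-formed code, suc v for the value v.

guard : ℕ → ℕ → ℕ
guard b v = ifz b (suc v) 0

-- Ill-formedness of either argument propagates; otherwise the successors marking well-formed
-- results are stripped first.
lift₂ : (ℕ → ℕ → ℕ) → ℕ → ℕ → ℕ
lift₂ f a b = ifz a 0 (ifz b 0 (f (a ∸ 1) (b ∸ 1)))

guard-recursive : Recursive 2 (λ xs → guard (lookup xs 0F) (lookup xs 1F))
guard-recursive = app ifz-recursive (arg 0F ∷ app suc-recursive (arg 1F ∷ []) ∷ const 0 ∷ [])

lift₂-recursive : ∀ f {g h : Vec ℕ n → ℕ} → Recursive 2 (λ xs → f (lookup xs 0F) (lookup xs 1F)) →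
                  Recursive n g → Recursive n h → Recursive n (λ xs → lift₂ f (g xs) (h xs))
lift₂-recursive _ f g h = app ifz-recursive (g ∷ const 0 ∷ app ifz-recursive (h ∷ const 0 ∷
  app f (app ∸-recursive (g ∷ const 1 ∷ []) ∷ app ∸-recursive (h ∷ const 1 ∷ []) ∷ []) ∷ []) ∷ [])

addValues : ℕ → ℕ → ℕ
addValues u v = suc (u + v)

termStep : (t a x y n e : ℕ) → ℕ
termStep t a x y n e = choose
  -- The difference is 0 exactly when a is the index of one of the n variables. The two constants
  -- below are well-formed only with body 0.
  ( guard (suc a ∸ n) (at e a)
  ∷ guard a 0
  ∷ guard a 1
  ∷ lift₂ addValues x y
  ∷ []) t

termRules : Vec ℕ 4 → ℕ
termRules xs = termStep (tag c) (body c) (recall c h (left c)) (recall c h (right c)) (lookup xs 2F) (lookup xs 3F)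
  where
  c = lookup xs 0F
  h = lookup xs 1F

termRules-recursive : Recursive 4 termRules
termRules-recursive = choose-recursive
  ( app guard-recursive
      (app ∸-recursive (app suc-recursive (a ∷ []) ∷ arg 2F ∷ []) ∷ app at-recursive (arg 3F ∷ a ∷ []) ∷ [])
  ∷ app guard-recursive (a ∷ const 0 ∷ [])
  ∷ app guard-recursive (a ∷ const 1 ∷ [])
  ∷ lift₂-recursive addValues (app suc-recursive (+-recursive ∷ []))
      (app recall-recursive (arg 0F ∷ arg 1F ∷ app left-recursive (arg 0F ∷ []) ∷ []))
      (app recall-recursive (arg 0F ∷ arg 1F ∷ app right-recursive (arg 0F ∷ []) ∷ []))
  ∷ []) (app π₁-recursive (arg 0F ∷ []))
  where
  a : Recursive 4 (λ xs → body (lookup xs 0F))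
  a = app π₂-recursive (arg 0F ∷ [])

private module Terms = CourseOfValues termRules

termValue : (c n e : ℕ) → ℕ
termValue c n e = Terms.fix c (n ∷ e ∷ [])

termValue-recursive : Recursive 3 (λ xs → termValue (lookup xs 0F) (lookup xs 1F) (lookup xs 2F))
termValue-recursive = respects (λ { (c ∷ n ∷ e ∷ []) → refl }) (Terms.fix-recursive termRules-recursive)

termValue-step : ∀ t a n e → termValue ⟨ t , a ⟩ n e ≡
                 termStep t a (termValue (π₁ a) n e) (termValue (π₂ a) n e) n e
termValue-step t a n e =
  trans (unfold ⟨ t , a ⟩)
    (cong₂ (λ t a → termStep t a (termValue (π₁ a) n e) (termValue (π₂ a) n e) n e) (π₁-⟨⟩ t a) (π₂-⟨⟩ t a))
  where
  unfold : ∀ c → termValue c n e ≡ termStep (tag c) (body c) (termValue (left c) n e) (termValue (right c) n e) n e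
  -- The history is empty here, but tag 0 means a variable, whose rule ignores both recalled values.
  unfold zero rewrite Terms.fix-unfold 0 (n ∷ e ∷ []) | π₁0≡0 = refl
  unfold (suc c) = trans (Terms.fix-unfold (suc c) (n ∷ e ∷ []))
    (cong₂ (λ x y → termStep (tag (suc c)) (body (suc c)) x y n e)
      (Terms.recall-history (suc c) _ (left< c)) (Terms.recall-history (suc c) _ (right< c)))

-- Built like `⌜_⌝ₜₛ`; the successor separates nonempty vectors from the empty one, so the code
-- determines the arity of a ground atom.
⌜_⌝ᵥ : Vec ℕ r → ℕ
⌜ []     ⌝ᵥ = 0
⌜ x ∷ xs ⌝ᵥ = suc ⟨ x , ⌜ xs ⌝ᵥ ⟩

-- The outer successor marks a well-formed result, the inner one belongs to the code of a nonempty
-- vector.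
consValues : ℕ → ℕ → ℕ
consValues u v = suc (suc ⟨ u , v ⟩)

vectorRules : Vec ℕ 4 → ℕ
vectorRules xs = ifz c 1 (lift₂ consValues
  (termValue (π₁ (c ∸ 1)) (lookup xs 2F) (lookup xs 3F))
  (recall c (lookup xs 1F) (π₂ (c ∸ 1))))
  where
  c = lookup xs 0F

vectorRules-recursive : Recursive 4 vectorRules
vectorRules-recursive = app ifz-recursive (arg 0F ∷ const 1 ∷
  lift₂-recursive consValues (app suc-recursive (app suc-recursive (⟨⟩-recursive ∷ []) ∷ []))
    (app termValue-recursive (app π₁-recursive (c-1 ∷ []) ∷ arg 2F ∷ arg 3F ∷ []))
    (app recall-recursive (arg 0F ∷ arg 1F ∷ app π₂-recursive (c-1 ∷ []) ∷ [])) ∷ [])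
  where
  c-1 : Recursive 4 (λ xs → lookup xs 0F ∸ 1)
  c-1 = app ∸-recursive (arg 0F ∷ const 1 ∷ [])

private module Vectors = CourseOfValues vectorRules

vectorValue : (c n e : ℕ) → ℕ
vectorValue c n e = Vectors.fix c (n ∷ e ∷ [])

vectorValue-recursive : Recursive 3 (λ xs → vectorValue (lookup xs 0F) (lookup xs 1F) (lookup xs 2F))
vectorValue-recursive = respects (λ { (c ∷ n ∷ e ∷ []) → refl }) (Vectors.fix-recursive vectorRules-recursive)

vectorValue-zero : ∀ n e → vectorValue 0 n e ≡ 1
vectorValue-zero n e = Vectors.fix-unfold 0 (n ∷ e ∷ [])

vectorValue-suc : ∀ c n e → vectorValue (suc c) n e ≡ lift₂ consValues (termValue (π₁ c) n e) (vectorValue (π₂ c) n e)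
vectorValue-suc c n e = trans (Vectors.fix-unfold (suc c) (n ∷ e ∷ []))
  (cong (lift₂ consValues (termValue (π₁ c) n e)) (Vectors.recall-history (suc c) _ (s≤s (π₂≤ c))))

-- Formulas evaluate to 0 (ill-formed or undetermined), 1 (false) or 2 (true).
-- The assignment V lists the truth values of the atoms, with 0 for false; it
-- determines the atoms with codes below M only.

test : ℕ → ℕ
test d = ifz d 2 1

equalValues leqValues lessValues : ℕ → ℕ → ℕ
equalValues u v = test ((u ∸ v) + (v ∸ u))
leqValues   u v = test (u ∸ v)
lessValues  u v = test (suc u ∸ v)

atomValue : (a V M : ℕ) → ℕ
atomValue a V M = ifz (suc a ∸ M) (ifz (at V a) 1 2) 0

predValue : (i w V M : ℕ) → ℕ
predValue i w V M = ifz w 0 (atomValue ⟨ i , w ∸ 1 ⟩ V M)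

negation : ℕ → ℕ
negation = choose (0 ∷ 2 ∷ 1 ∷ [])

-- Strict even where one argument settles the truth value: a nonzero result must certify that both
-- subformulas are well-formed.
connective : (ff ft tf tt : ℕ) → ℕ → ℕ → ℕ
connective ff ft tf tt x y = choose (0 ∷ choose (0 ∷ ff ∷ ft ∷ []) y ∷ choose (0 ∷ tf ∷ tt ∷ []) y ∷ []) x

-- The tags 8 and 9 of the quantifiers are left to the default 0, so a nonzero value also certifies
-- quantifier-freeness.
formulaStep : (t i s u w z x y V M : ℕ) → ℕ
formulaStep t i s u w z x y V M = choose
  ( lift₂ equalValues s u
  ∷ lift₂ leqValues s u
  ∷ lift₂ lessValues s u
  ∷ predValue i w V M
  ∷ negation z
  ∷ connective 1 1 1 2 x y
  ∷ connective 1 2 2 2 x y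
  ∷ connective 2 2 1 2 x y
  ∷ []) t

formulaRules : Vec ℕ 6 → ℕ
formulaRules xs = formulaStep (tag c) (left c)
  (termValue (left c) vars e) (termValue (right c) vars e) (vectorValue (right c) vars e)
  (recall c h (body c)) (recall c h (left c)) (recall c h (right c)) (lookup xs 4F) (lookup xs 5F)
  where
  c = lookup xs 0F
  h = lookup xs 1F
  vars = lookup xs 2F
  e = lookup xs 3F

test-recursive : Recursive 1 (λ xs → test (lookup xs 0F))
test-recursive = app ifz-recursive (arg 0F ∷ const 2 ∷ const 1 ∷ [])

connective-recursive : ∀ ff ft tf tt → Recursive 2 (λ xs → connective ff ft tf tt (lookup xs 0F) (lookup xs 1F))
connective-recursive ff ft tf tt = choose-recursive
  ( const 0
  ∷ choose-recursive (const 0 ∷ const ff ∷ const ft ∷ []) (arg 1F)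
  ∷ choose-recursive (const 0 ∷ const tf ∷ const tt ∷ []) (arg 1F)
  ∷ []) (arg 0F)

predValue-recursive : Recursive 4 (λ xs → predValue (lookup xs 0F) (lookup xs 1F) (lookup xs 2F) (lookup xs 3F))
predValue-recursive = app ifz-recursive (arg 1F ∷ const 0 ∷
  app ifz-recursive (app ∸-recursive (app suc-recursive (atom ∷ []) ∷ arg 3F ∷ []) ∷
    app ifz-recursive (app at-recursive (arg 2F ∷ atom ∷ []) ∷ const 1 ∷ const 2 ∷ []) ∷
    const 0 ∷ []) ∷ [])
  where
  atom : Recursive 4 (λ xs → ⟨ lookup xs 0F , lookup xs 1F ∸ 1 ⟩)
  atom = app ⟨⟩-recursive (arg 0F ∷ app ∸-recursive (arg 1F ∷ const 1 ∷ []) ∷ [])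

formulaRules-recursive : Recursive 6 formulaRules
formulaRules-recursive = choose-recursive
  ( lift₂-recursive equalValues
      (app test-recursive (app +-recursive (∸-recursive ∷ app ∸-recursive (arg 1F ∷ arg 0F ∷ []) ∷ []) ∷ [])) s u
  ∷ lift₂-recursive leqValues (app test-recursive (∸-recursive ∷ [])) s u
  ∷ lift₂-recursive lessValues
      (app test-recursive (app ∸-recursive (app suc-recursive (arg 0F ∷ []) ∷ arg 1F ∷ []) ∷ [])) s u
  ∷ app predValue-recursive (i ∷ app vectorValue-recursive (j ∷ arg 2F ∷ arg 3F ∷ []) ∷ arg 4F ∷ arg 5F ∷ [])
  ∷ choose-recursive (const 0 ∷ const 2 ∷ const 1 ∷ [])
      (app recall-recursive (arg 0F ∷ arg 1F ∷ app π₂-recursive (arg 0F ∷ []) ∷ []))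
  ∷ app (connective-recursive 1 1 1 2) (x ∷ y ∷ [])
  ∷ app (connective-recursive 1 2 2 2) (x ∷ y ∷ [])
  ∷ app (connective-recursive 2 2 1 2) (x ∷ y ∷ [])
  ∷ []) (app π₁-recursive (arg 0F ∷ []))
  where
  i : Recursive 6 (λ xs → left (lookup xs 0F))
  i = app left-recursive (arg 0F ∷ [])
  j : Recursive 6 (λ xs → right (lookup xs 0F))
  j = app right-recursive (arg 0F ∷ [])
  s : Recursive 6 (λ xs → termValue (left (lookup xs 0F)) (lookup xs 2F) (lookup xs 3F))
  s = app termValue-recursive (i ∷ arg 2F ∷ arg 3F ∷ [])
  u : Recursive 6 (λ xs → termValue (right (lookup xs 0F)) (lookup xs 2F) (lookup xs 3F))
  u = app termValue-recursive (j ∷ arg 2F ∷ arg 3F ∷ [])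
  x : Recursive 6 (λ xs → recall (lookup xs 0F) (lookup xs 1F) (left (lookup xs 0F)))
  x = app recall-recursive (arg 0F ∷ arg 1F ∷ i ∷ [])
  y : Recursive 6 (λ xs → recall (lookup xs 0F) (lookup xs 1F) (right (lookup xs 0F)))
  y = app recall-recursive (arg 0F ∷ arg 1F ∷ j ∷ [])

private module Formulas = CourseOfValues formulaRules

formulaValue : (c n e V M : ℕ) → ℕ
formulaValue c n e V M = Formulas.fix c (n ∷ e ∷ V ∷ M ∷ [])

formulaValue-recursive :
  Recursive 5 (λ xs → formulaValue (lookup xs 0F) (lookup xs 1F) (lookup xs 2F) (lookup xs 3F) (lookup xs 4F))
formulaValue-recursive = respects (λ { (c ∷ n ∷ e ∷ V ∷ M ∷ []) → refl }) (Formulas.fix-recursive formulaRules-recursive)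

formulaValue-step : ∀ t a n e V M → formulaValue ⟨ t , a ⟩ n e V M ≡
  formulaStep t (π₁ a) (termValue (π₁ a) n e) (termValue (π₂ a) n e) (vectorValue (π₂ a) n e)
    (formulaValue a n e V M) (formulaValue (π₁ a) n e V M) (formulaValue (π₂ a) n e V M) V M
formulaValue-step t a n e V M = trans (unfold ⟨ t , a ⟩) (cong₂ step (π₁-⟨⟩ t a) (π₂-⟨⟩ t a))
  where
  step : ℕ → ℕ → ℕ
  step t a = formulaStep t (π₁ a) (termValue (π₁ a) n e) (termValue (π₂ a) n e) (vectorValue (π₂ a) n e)
    (formulaValue a n e V M) (formulaValue (π₁ a) n e V M) (formulaValue (π₂ a) n e V M) V M

  unfold : ∀ c → formulaValue c n e V M ≡ step (tag c) (body c)
  rules : (t c z x y : ℕ) → ℕ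
  rules t c z x y = formulaStep t (left c)
    (termValue (left c) n e) (termValue (right c) n e) (vectorValue (right c) n e) z x y V M

  earlier value : ℕ → ℕ
  earlier j = recall 0 (Formulas.history 0 (n ∷ e ∷ V ∷ M ∷ [])) j
  value j = formulaValue j n e V M

  rules-cong : ∀ {t c z x y z′ x′ y′} → z ≡ z′ → x ≡ x′ → y ≡ y′ → rules t c z x y ≡ rules t c z′ x′ y′
  rules-cong refl refl refl = refl

  -- The code 0 is an atomic formula, so that nothing is recalled for it.
  rules-zero : ∀ {t} (f g : ℕ → ℕ) → t ≡ 0 → rules t 0 (f (body 0)) (f (left 0)) (f (right 0)) ≡
                                   rules t 0 (g (body 0)) (g (left 0)) (g (right 0))
  rules-zero _ _ refl = refl

  unfold zero = trans (Formulas.fix-unfold 0 (n ∷ e ∷ V ∷ M ∷ []))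
    (rules-zero earlier value π₁0≡0)
  unfold (suc c) = trans (Formulas.fix-unfold (suc c) (n ∷ e ∷ V ∷ M ∷ []))
    (rules-cong {t = tag (suc c)} {c = suc c}
      (Formulas.recall-history (suc c) (n ∷ e ∷ V ∷ M ∷ []) (π₂< c))
      (Formulas.recall-history (suc c) (n ∷ e ∷ V ∷ M ∷ []) (left< c))
      (Formulas.recall-history (suc c) (n ∷ e ∷ V ∷ M ∷ []) (right< c)))

-- Parsing

lift₂-defined : ∀ f a {b} → lift₂ f a b ≢ 0 → a ≢ 0 × b ≢ 0
lift₂-defined f zero            ≢0 = contradiction refl ≢0
lift₂-defined f (suc a) {zero}  ≢0 = contradiction refl ≢0
lift₂-defined f (suc a) {suc b} _  = (λ ()) , (λ ())

negation-defined : ∀ x → negation x ≢ 0 → x ≢ 0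
negation-defined zero    ≢0 = ≢0
negation-defined (suc _) _  = λ ()

connective-defined : ∀ ff ft tf tt x y → connective ff ft tf tt x y ≢ 0 → x ≢ 0 × y ≢ 0
connective-defined _ _ _ _ zero                _       ≢0 = contradiction refl ≢0
connective-defined _ _ _ _ (suc zero)          zero    ≢0 = contradiction refl ≢0
connective-defined _ _ _ _ (suc (suc zero))    zero    ≢0 = contradiction refl ≢0
connective-defined _ _ _ _ (suc (suc (suc _))) _       ≢0 = contradiction refl ≢0
connective-defined _ _ _ _ (suc _)             (suc _) _  = (λ ()) , (λ ())

π₁<⟨1+t,a⟩ : ∀ {c} t a → ⟨ suc t , a ⟩ ≡ c → π₁ a < c
π₁<⟨1+t,a⟩ t a refl = ≤-<-trans (π₁≤ a) (b<⟨1+a,b⟩ t a)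

π₂<⟨1+t,a⟩ : ∀ {c} t a → ⟨ suc t , a ⟩ ≡ c → π₂ a < c
π₂<⟨1+t,a⟩ t a refl = ≤-<-trans (π₂≤ a) (b<⟨1+a,b⟩ t a)

node-code : ∀ {c x y} t a → ⟨ t , a ⟩ ≡ c → x ≡ π₁ a → y ≡ π₂ a → ⟨ t , ⟨ x , y ⟩ ⟩ ≡ c
node-code t a refl refl refl = cong ⟨ t ,_⟩ (⟨π₁,π₂⟩ a)

-- Evaluation doubles as a syntax check: a nonzero value means that every check on the way passed.
-- Tag and body are generalised to variables so that the rule reduces once the tag is matched.
parse-term : ∀ {n e} c → Acc _<_ c → termValue c n e ≢ 0 → ∃[ t ] ⌜_⌝ₜ {n} t ≡ c
parse-term {n} {e} c (acc rs) c≢0 = by-tag (π₁ c) (π₂ c) (⟨π₁,π₂⟩ c)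
  λ eq → c≢0 (trans (cong (λ c → termValue c n e) (sym (⟨π₁,π₂⟩ c))) (trans (termValue-step (π₁ c) (π₂ c) n e) eq))
  where
  by-tag : ∀ t a → ⟨ t , a ⟩ ≡ c →
           termStep t a (termValue (π₁ a) n e) (termValue (π₂ a) n e) n e ≢ 0 → ∃[ t ] ⌜_⌝ₜ {n} t ≡ c
  by-tag 0 a eq ≢0 with suc a ∸ n in a∸n
  ... | zero  = var (fromℕ< a<n) , trans (cong ⟨ 0 ,_⟩ (toℕ-fromℕ< a<n)) eq
    where
    a<n : a < n
    a<n = m∸n≡0⇒m≤n a∸n
  ... | suc _ = contradiction refl ≢0
  by-tag 1 zero    eq _  = `0 , eq
  by-tag 1 (suc _) eq ≢0 = contradiction refl ≢0
  by-tag 2 zero    eq _  = `1 , eq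
  by-tag 2 (suc _) eq ≢0 = contradiction refl ≢0
  by-tag 3 a eq ≢0
    with x≢0 , y≢0 ← lift₂-defined addValues (termValue (π₁ a) n e) ≢0
    with s , s-code ← parse-term (π₁ a) (rs (π₁<⟨1+t,a⟩ 2 a eq)) x≢0
       | t , t-code ← parse-term (π₂ a) (rs (π₂<⟨1+t,a⟩ 2 a eq)) y≢0
    = s `+ t , node-code 3 a eq s-code t-code
  by-tag (suc (suc (suc (suc _)))) a eq ≢0 = contradiction refl ≢0

parse-vector : ∀ {n e} c → Acc _<_ c → vectorValue c n e ≢ 0 → ∃[ r ] ∃[ ts ] ⌜_⌝ₜₛ {n} {r} ts ≡ c
parse-vector zero _ _ = 0 , [] , refl
parse-vector {n} {e} (suc c) (acc rs) ≢0
  with x≢0 , y≢0 ← lift₂-defined consValues (termValue (π₁ c) n e) (≢0 ∘ trans (vectorValue-suc c n e))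
  with t , t-code ← parse-term (π₁ c) (<-wellFounded _) x≢0
     | r , ts , ts-code ← parse-vector (π₂ c) (rs (s≤s (π₂≤ c))) y≢0
  = suc r , t ∷ ts , cong suc (trans (cong₂ ⟨_,_⟩ t-code ts-code) (⟨π₁,π₂⟩ c))

-- The search guesses the matrix as a bare number; one nonzero value turns it back into a formula.
parse-formula : ∀ {n e V M} c → Acc _<_ c → formulaValue c n e V M ≢ 0 →
                ∃[ φ ] QuantifierFree {n} φ × ⌜ φ ⌝ ≡ c
parse-formula {n} {e} {V} {M} c (acc rs) c≢0 = by-tag (π₁ c) (π₂ c) (⟨π₁,π₂⟩ c)
  λ eq → c≢0 (trans (cong (λ c → formulaValue c n e V M) (sym (⟨π₁,π₂⟩ c)))
    (trans (formulaValue-step (π₁ c) (π₂ c) n e V M) eq))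
  where
  terms : ∀ f a → lift₂ f (termValue (π₁ a) n e) (termValue (π₂ a) n e) ≢ 0 →
          ∃[ s ] ∃[ t ] ⌜_⌝ₜ {n} s ≡ π₁ a × ⌜_⌝ₜ {n} t ≡ π₂ a
  terms f a ≢0
    with x≢0 , y≢0 ← lift₂-defined f (termValue (π₁ a) n e) ≢0
    with s , s-code ← parse-term (π₁ a) (<-wellFounded _) x≢0
       | t , t-code ← parse-term (π₂ a) (<-wellFounded _) y≢0
    = s , t , s-code , t-code

  formulas : ∀ t ff ft tf tt a → ⟨ suc t , a ⟩ ≡ c →
             connective ff ft tf tt (formulaValue (π₁ a) n e V M) (formulaValue (π₂ a) n e V M) ≢ 0 →
             ∃[ φ ] ∃[ ψ ] QuantifierFree {n} φ × QuantifierFree ψ × ⌜ φ ⌝ ≡ π₁ a × ⌜ ψ ⌝ ≡ π₂ a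
  formulas t ff ft tf tt a eq ≢0
    with x≢0 , y≢0 ← connective-defined ff ft tf tt (formulaValue (π₁ a) n e V M) (formulaValue (π₂ a) n e V M) ≢0
    with φ , φ-qf , φ-code ← parse-formula (π₁ a) (rs (π₁<⟨1+t,a⟩ t a eq)) x≢0
       | ψ , ψ-qf , ψ-code ← parse-formula (π₂ a) (rs (π₂<⟨1+t,a⟩ t a eq)) y≢0
    = φ , ψ , φ-qf , ψ-qf , φ-code , ψ-code

  by-tag : ∀ t a → ⟨ t , a ⟩ ≡ c →
    formulaStep t (π₁ a) (termValue (π₁ a) n e) (termValue (π₂ a) n e) (vectorValue (π₂ a) n e)
      (formulaValue a n e V M) (formulaValue (π₁ a) n e V M) (formulaValue (π₂ a) n e V M) V M ≢ 0 →
    ∃[ φ ] QuantifierFree {n} φ × ⌜ φ ⌝ ≡ c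
  by-tag 0 a eq ≢0 with s , t , s-code , t-code ← terms equalValues a ≢0 =
    (s `= t) , qf-= , node-code 0 a eq s-code t-code
  by-tag 1 a eq ≢0 with s , t , s-code , t-code ← terms leqValues a ≢0 =
    (s `≤ t) , qf-≤ , node-code 1 a eq s-code t-code
  by-tag 2 a eq ≢0 with s , t , s-code , t-code ← terms lessValues a ≢0 =
    (s `< t) , qf-< , node-code 2 a eq s-code t-code
  by-tag 3 a eq ≢0 with r , ts , ts-code ← parse-vector (π₂ a) (<-wellFounded _)
                            (≢0 ∘ cong (λ w → predValue (π₁ a) w V M)) =
    pred (π₁ a) ts , qf-pred , node-code 3 a eq refl ts-code
  by-tag 4 a eq ≢0
    with φ , φ-qf , φ-code ← parse-formula a (rs (subst (a <_) eq (b<⟨1+a,b⟩ 3 a)))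
                           (negation-defined (formulaValue a n e V M) ≢0) =
    (`¬ φ) , qf-¬ φ-qf , trans (cong ⟨ 4 ,_⟩ φ-code) eq
  by-tag 5 a eq ≢0 with φ , ψ , φ-qf , ψ-qf , φ-code , ψ-code ← formulas 4 1 1 1 2 a eq ≢0 =
    (φ `∧ ψ) , qf-∧ φ-qf ψ-qf , node-code 5 a eq φ-code ψ-code
  by-tag 6 a eq ≢0 with φ , ψ , φ-qf , ψ-qf , φ-code , ψ-code ← formulas 5 1 2 2 2 a eq ≢0 =
    (φ `∨ ψ) , qf-∨ φ-qf ψ-qf , node-code 6 a eq φ-code ψ-code
  by-tag 7 a eq ≢0 with φ , ψ , φ-qf , ψ-qf , φ-code , ψ-code ← formulas 6 2 2 1 2 a eq ≢0 =
    (φ `→ ψ) , qf-→ φ-qf ψ-qf , node-code 7 a eq φ-code ψ-code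
  by-tag (suc (suc (suc (suc (suc (suc (suc (suc _)))))))) a eq ≢0 = contradiction refl ≢0

-- Correctness of the evaluation

module _ {n} (ρ : Vec ℕ n) {e} (e-lists-ρ : ∀ i → at e (toℕ i) ≡ lookup ρ i) where

  term-value : ∀ t → termValue ⌜ t ⌝ₜ n e ≡ suc (⟦ t ⟧ ρ)
  term-value (var x) = trans (termValue-step 0 (toℕ x) n e)
    (trans (cong (λ d → ifz d (suc (at e (toℕ x))) 0) (m≤n⇒m∸n≡0 (toℕ<n x))) (cong suc (e-lists-ρ x)))
  term-value `0 = termValue-step 1 0 n e
  term-value `1 = termValue-step 2 0 n e
  term-value (s `+ t) = trans (termValue-step 3 ⟨ ⌜ s ⌝ₜ , ⌜ t ⌝ₜ ⟩ n e)
    (cong₂ (lift₂ addValues)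
      (trans (cong (λ c → termValue c n e) (π₁-⟨⟩ ⌜ s ⌝ₜ ⌜ t ⌝ₜ)) (term-value s))
      (trans (cong (λ c → termValue c n e) (π₂-⟨⟩ ⌜ s ⌝ₜ ⌜ t ⌝ₜ)) (term-value t)))

  vector-value : ∀ (ts : Vec (Term n) r) → vectorValue ⌜ ts ⌝ₜₛ n e ≡ suc ⌜ map (λ t → ⟦ t ⟧ ρ) ts ⌝ᵥ
  vector-value [] = vectorValue-zero n e
  vector-value (t ∷ ts) = trans (vectorValue-suc ⟨ ⌜ t ⌝ₜ , ⌜ ts ⌝ₜₛ ⟩ n e)
    (cong₂ (lift₂ consValues)
      (trans (cong (λ c → termValue c n e) (π₁-⟨⟩ ⌜ t ⌝ₜ ⌜ ts ⌝ₜₛ)) (term-value t))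
      (trans (cong (λ c → vectorValue c n e) (π₂-⟨⟩ ⌜ t ⌝ₜ ⌜ ts ⌝ₜₛ)) (vector-value ts)))

-- D is to be sufficient for the truth of P to be determined.

data Verdict (D P : Set) : ℕ → Set where
  undetermined : ¬ D → Verdict D P 0
  false        : ¬ P → Verdict D P 1
  true         : P → Verdict D P 2

verdict-negation : ∀ {D P z} → Verdict D P z → Verdict D (¬ P) (negation z)
verdict-negation (undetermined ¬d) = undetermined ¬d
verdict-negation (false ¬p)        = true ¬p
verdict-negation (true p)          = false (λ ¬p → ¬p p)

module _ {D E P Q : Set} where

  verdict-∧ : ∀ {x y} → Verdict D P x → Verdict E Q y → Verdict (D × E) (P × Q) (connective 1 1 1 2 x y)
  verdict-∧ (undetermined ¬d) _                 = undetermined (¬d ∘ proj₁)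
  verdict-∧ (false _)         (undetermined ¬e) = undetermined (¬e ∘ proj₂)
  verdict-∧ (true _)          (undetermined ¬e) = undetermined (¬e ∘ proj₂)
  verdict-∧ (false ¬p)        (false _)         = false (¬p ∘ proj₁)
  verdict-∧ (false ¬p)        (true _)          = false (¬p ∘ proj₁)
  verdict-∧ (true _)          (false ¬q)        = false (¬q ∘ proj₂)
  verdict-∧ (true p)          (true q)          = true (p , q)

  verdict-∨ : ∀ {x y} → Verdict D P x → Verdict E Q y → Verdict (D × E) (P ⊎ Q) (connective 1 2 2 2 x y)
  verdict-∨ (undetermined ¬d) _                 = undetermined (¬d ∘ proj₁)
  verdict-∨ (false _)         (undetermined ¬e) = undetermined (¬e ∘ proj₂)
  verdict-∨ (true _)          (undetermined ¬e) = undetermined (¬e ∘ proj₂)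
  verdict-∨ (false ¬p)        (false ¬q)        = false [ ¬p , ¬q ]
  verdict-∨ (false _)         (true q)          = true (inj₂ q)
  verdict-∨ (true p)          (false _)         = true (inj₁ p)
  verdict-∨ (true p)          (true _)          = true (inj₁ p)

  verdict-→ : ∀ {x y} → Verdict D P x → Verdict E Q y → Verdict (D × E) (P → Q) (connective 2 2 1 2 x y)
  verdict-→ (undetermined ¬d) _                 = undetermined (¬d ∘ proj₁)
  verdict-→ (false _)         (undetermined ¬e) = undetermined (¬e ∘ proj₂)
  verdict-→ (true _)          (undetermined ¬e) = undetermined (¬e ∘ proj₂)
  verdict-→ (false ¬p)        (false _)         = true (λ p → contradiction p ¬p)
  verdict-→ (false _)         (true q)          = true (λ _ → q)
  verdict-→ (true p)          (false ¬q)        = false (λ p→q → ¬q (p→q p))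
  verdict-→ (true _)          (true q)          = true (λ _ → q)

verdict-test : ∀ {D P d} → (d ≡ 0 → P) → (P → d ≡ 0) → Verdict D P (test d)
verdict-test {d = zero}  d≡0⇒p _     = true (d≡0⇒p refl)
verdict-test {d = suc _} _     p⇒d≡0 = false (λ p → contradiction (p⇒d≡0 p) λ ())

-- The condition `D` is arbitrary here and for the two order relations, because ground arithmetic is
-- never undetermined.
verdict-= : ∀ {D} u v → Verdict D (u ≡ v) (equalValues u v)
verdict-= u v = verdict-test
  (λ eq → ≤-antisym (m∸n≡0⇒m≤n (m+n≡0⇒m≡0 (u ∸ v) eq)) (m∸n≡0⇒m≤n (m+n≡0⇒n≡0 (u ∸ v) eq)))
  (λ { refl → cong₂ _+_ (n∸n≡0 u) (n∸n≡0 u) })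

verdict-≤ : ∀ {D} u v → Verdict D (∃[ z ] u + z ≡ v) (leqValues u v)
verdict-≤ u v = verdict-test
  (λ eq → v ∸ u , m+[n∸m]≡n (m∸n≡0⇒m≤n eq))
  (λ { (z , refl) → m≤n⇒m∸n≡0 (m≤m+n u z) })

verdict-< : ∀ {D} u v → Verdict D (∃[ z ] u + 1 + z ≡ v) (lessValues u v)
verdict-< {D} u v = subst (λ w → Verdict D (∃[ z ] u + 1 + z ≡ v) (leqValues w v)) (+-comm u 1) (verdict-≤ (u + 1) v)

-- For a quantifier-free formula this exceeds the codes of all uninterpreted atoms of the instance
-- at ρ; sums stand in for maxima.
bound : Formula n → Vec ℕ n → ℕ
bound (pred i ts) ρ = suc ⟨ i , ⌜ map (λ t → ⟦ t ⟧ ρ) ts ⌝ᵥ ⟩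
bound (`¬ φ)      ρ = bound φ ρ
bound (φ `∧ ψ)    ρ = bound φ ρ + bound ψ ρ
bound (φ `∨ ψ)    ρ = bound φ ρ + bound ψ ρ
bound (φ `→ ψ)    ρ = bound φ ρ + bound ψ ρ
bound _           ρ = 0

Agrees : Interpretation → ℕ → ℕ → Set
Agrees I V M = ∀ {r} i (v : Vec ℕ r) → ⟨ i , ⌜ v ⌝ᵥ ⟩ < M →
               (at V ⟨ i , ⌜ v ⌝ᵥ ⟩ ≡ 0 → ¬ I r i v) × (at V ⟨ i , ⌜ v ⌝ᵥ ⟩ ≢ 0 → I r i v)

module _ (I : Interpretation) {V M} (agrees : Agrees I V M)
         {n} (ρ : Vec ℕ n) {e} (e-lists-ρ : ∀ i → at e (toℕ i) ≡ lookup ρ i) where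

  private
    Correct : Formula n → ℕ → Set
    Correct φ = Verdict (bound φ ρ ≤ M) (I , ρ ⊨ φ)

    comparison : ∀ f s s′ →
      lift₂ f (termValue (π₁ ⟨ ⌜ s ⌝ₜ , ⌜ s′ ⌝ₜ ⟩) n e) (termValue (π₂ ⟨ ⌜ s ⌝ₜ , ⌜ s′ ⌝ₜ ⟩) n e) ≡
      f (⟦ s ⟧ ρ) (⟦ s′ ⟧ ρ)
    comparison f s s′ = cong₂ (lift₂ f)
      (trans (cong (λ c → termValue c n e) (π₁-⟨⟩ ⌜ s ⌝ₜ ⌜ s′ ⌝ₜ)) (term-value ρ e-lists-ρ s))
      (trans (cong (λ c → termValue c n e) (π₂-⟨⟩ ⌜ s ⌝ₜ ⌜ s′ ⌝ₜ)) (term-value ρ e-lists-ρ s′))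

    binary : ∀ (f : ℕ → ℕ → ℕ) (φ ψ : Formula n) →
      f (formulaValue (π₁ ⟨ ⌜ φ ⌝ , ⌜ ψ ⌝ ⟩) n e V M) (formulaValue (π₂ ⟨ ⌜ φ ⌝ , ⌜ ψ ⌝ ⟩) n e V M) ≡
      f (formulaValue ⌜ φ ⌝ n e V M) (formulaValue ⌜ ψ ⌝ n e V M)
    binary f φ ψ = cong₂ (λ c d → f (formulaValue c n e V M) (formulaValue d n e V M))
      (π₁-⟨⟩ ⌜ φ ⌝ ⌜ ψ ⌝) (π₂-⟨⟩ ⌜ φ ⌝ ⌜ ψ ⌝)

    sum : ∀ {P : Set} φ ψ {z} → Verdict (bound φ ρ ≤ M × bound ψ ρ ≤ M) P z → Verdict (bound φ ρ + bound ψ ρ ≤ M) P z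
    sum φ ψ (undetermined ¬d) = undetermined λ ≤M →
      ¬d (≤-trans (m≤m+n (bound φ ρ) (bound ψ ρ)) ≤M , ≤-trans (m≤n+m (bound ψ ρ) (bound φ ρ)) ≤M)
    sum _ _ (false ¬p) = false ¬p
    sum _ _ (true p)   = true p

    atom : ∀ {r} i (v : Vec ℕ r) → Verdict (suc ⟨ i , ⌜ v ⌝ᵥ ⟩ ≤ M) (I r i v) (atomValue ⟨ i , ⌜ v ⌝ᵥ ⟩ V M)
    atom i v with suc ⟨ i , ⌜ v ⌝ᵥ ⟩ ∸ M in eq | at V ⟨ i , ⌜ v ⌝ᵥ ⟩ | agrees i v
    ... | suc _ | _     | _ = undetermined λ <M → contradiction (trans (sym eq) (m≤n⇒m∸n≡0 <M)) λ ()
    ... | zero  | zero  | agree = false (proj₁ (agree (m∸n≡0⇒m≤n eq)) refl)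
    ... | zero  | suc _ | agree = true (proj₂ (agree (m∸n≡0⇒m≤n eq)) λ ())

  -- A value 1 or 2 is right for every interpretation agreeing with V below M, whatever holds
  -- beyond; once M reaches the bound of the instance, the value 0 is excluded.
  verdict : ∀ {φ} → QuantifierFree φ → Correct φ (formulaValue ⌜ φ ⌝ n e V M)
  verdict (qf-= {s} {t}) = subst (Correct (s `= t))
    (sym (trans (formulaValue-step 0 ⟨ ⌜ s ⌝ₜ , ⌜ t ⌝ₜ ⟩ n e V M) (comparison equalValues s t)))
    (verdict-= (⟦ s ⟧ ρ) (⟦ t ⟧ ρ))
  verdict (qf-≤ {s} {t}) = subst (Correct (s `≤ t))
    (sym (trans (formulaValue-step 1 ⟨ ⌜ s ⌝ₜ , ⌜ t ⌝ₜ ⟩ n e V M) (comparison leqValues s t)))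
    (verdict-≤ (⟦ s ⟧ ρ) (⟦ t ⟧ ρ))
  verdict (qf-< {s} {t}) = subst (Correct (s `< t))
    (sym (trans (formulaValue-step 2 ⟨ ⌜ s ⌝ₜ , ⌜ t ⌝ₜ ⟩ n e V M) (comparison lessValues s t)))
    (verdict-< (⟦ s ⟧ ρ) (⟦ t ⟧ ρ))
  verdict (qf-pred {i = i} {ts}) = subst (Correct (pred i ts))
    (sym (trans (formulaValue-step 3 ⟨ i , ⌜ ts ⌝ₜₛ ⟩ n e V M)
      (cong₂ (λ i w → predValue i w V M) (π₁-⟨⟩ i ⌜ ts ⌝ₜₛ)
        (trans (cong (λ c → vectorValue c n e) (π₂-⟨⟩ i ⌜ ts ⌝ₜₛ)) (vector-value ρ e-lists-ρ ts)))))
    (atom i (map (λ t → ⟦ t ⟧ ρ) ts))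
  verdict (qf-¬ {φ} φ-qf) = subst (Correct (`¬ φ)) (sym (formulaValue-step 4 ⌜ φ ⌝ n e V M))
    (verdict-negation (verdict φ-qf))
  verdict (qf-∧ {φ} {ψ} φ-qf ψ-qf) = subst (Correct (φ `∧ ψ))
    (sym (trans (formulaValue-step 5 ⟨ ⌜ φ ⌝ , ⌜ ψ ⌝ ⟩ n e V M) (binary (connective 1 1 1 2) φ ψ)))
    (sum φ ψ (verdict-∧ (verdict φ-qf) (verdict ψ-qf)))
  verdict (qf-∨ {φ} {ψ} φ-qf ψ-qf) = subst (Correct (φ `∨ ψ))
    (sym (trans (formulaValue-step 6 ⟨ ⌜ φ ⌝ , ⌜ ψ ⌝ ⟩ n e V M) (binary (connective 1 2 2 2) φ ψ)))
    (sum φ ψ (verdict-∨ (verdict φ-qf) (verdict ψ-qf)))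
  verdict (qf-→ {φ} {ψ} φ-qf ψ-qf) = subst (Correct (φ `→ ψ))
    (sym (trans (formulaValue-step 7 ⟨ ⌜ φ ⌝ , ⌜ ψ ⌝ ⟩ n e V M) (binary (connective 2 2 1 2) φ ψ)))
    (sum φ ψ (verdict-→ (verdict φ-qf) (verdict ψ-qf)))

-- Unbounded search

lookup-extensional : ∀ {xs ys : Vec ℕ n} → (∀ i → lookup xs i ≡ lookup ys i) → xs ≡ ys
lookup-extensional {xs = xs} {ys} eq =
  trans (sym (tabulate∘lookup xs)) (trans (tabulate-cong eq) (tabulate∘lookup ys))

-- For `mu`, the smaller of two different results would give f both the value 0 and a successor.
⇓-functional : ∀ {f : Rec n} {xs y z} → f [ xs ]⇓ y → f [ xs ]⇓ z → y ≡ z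
⇓-functional zero⇓ zero⇓ = refl
⇓-functional succ⇓ succ⇓ = refl
⇓-functional proj⇓ proj⇓ = refl
⇓-functional (comp⇓ {ys = ys} gs⇓ f⇓) (comp⇓ {ys = ys′} gs⇓′ f⇓′)
  with refl ← lookup-extensional {xs = ys} {ys′} (λ i → ⇓-functional (gs⇓ i) (gs⇓′ i)) = ⇓-functional f⇓ f⇓′
⇓-functional (prec⇓-zero f⇓) (prec⇓-zero f⇓′) = ⇓-functional f⇓ f⇓′
⇓-functional (prec⇓-suc r⇓ g⇓) (prec⇓-suc r⇓′ g⇓′)
  with refl ← ⇓-functional r⇓ r⇓′ = ⇓-functional g⇓ g⇓′
⇓-functional (mu⇓ {k = i} below f⇓) (mu⇓ {k = j} below′ f⇓′) with <-cmp i j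
... | tri< i<j _ _ = contradiction (⇓-functional f⇓ (proj₂ (below′ i i<j))) λ ()
... | tri≈ _ i≡j _ = i≡j
... | tri> _ _ j<i = contradiction (⇓-functional (proj₂ (below j j<i)) f⇓′) λ ()

least-zero : ∀ (f : ℕ → ℕ) n → (∀ i → i < n → ∃[ v ] f i ≡ suc v) ⊎
                               (∃[ k ] (∀ i → i < k → ∃[ v ] f i ≡ suc v) × f k ≡ 0)
least-zero f zero = inj₁ λ _ ()
least-zero f (suc n) with least-zero f n | f n in eq
... | inj₂ found | _     = inj₂ found
... | inj₁ none  | zero  = inj₂ (n , none , eq)
... | inj₁ none  | suc v = inj₁ λ i i<1+n → [ none i , (λ { refl → v , eq }) ] (m≤n⇒m<n∨m≡n (s≤s⁻¹ i<1+n))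

search⇓ : ∀ {f} {xs : Vec ℕ n} (c : Recursive (suc n) f) →
          (∃[ w ] f (w ∷ xs) ≡ 0) ⇔ (∃[ y ] mu (code c) [ xs ]⇓ y)
search⇓ {f = f} {xs} c = mk⇔ halts found
  where
  halts : ∃[ w ] f (w ∷ xs) ≡ 0 → ∃[ y ] mu (code c) [ xs ]⇓ y
  halts (w , f≡0) with least-zero (λ i → f (i ∷ xs)) (suc w)
  ... | inj₁ none = contradiction (trans (sym f≡0) (proj₂ (none w ≤-refl))) λ ()
  ... | inj₂ (k , below , f≡0) = k , mu⇓
    (λ i i<k → proj₁ (below i i<k) , subst (code c [ i ∷ xs ]⇓_) (proj₂ (below i i<k)) (computes c (i ∷ xs)))
    (subst (code c [ k ∷ xs ]⇓_) f≡0 (computes c (k ∷ xs)))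
  found : ∃[ y ] mu (code c) [ xs ]⇓ y → ∃[ w ] f (w ∷ xs) ≡ 0
  found (k , mu⇓ _ f⇓) = k , ⇓-functional (computes c (k ∷ xs)) f⇓

-- Compactness of Cantor space

Agree : ℕ → (α β : ℕ → Bool) → Set
Agree n α β = ∀ i → i < n → α i ≡ β i

-- König's lemma on the binary tree: a prefix stays in play while, for every N, some extension meets
-- the first N conditions. Locality lets the limit branch inherit each condition.
module Compactness (lem : ExcludedMiddle 0ℓ) (P : ℕ → (ℕ → Bool) → Set) (modulus : ℕ → ℕ)
  (local : ∀ e {α β} → Agree (modulus e) α β → P e α → P e β)
  (finitely-satisfiable : ∀ N → ∃[ α ] (∀ e → e < N → P e α)) where

  private
    Consistent : ℕ → (ℕ → Bool) → Set
    Consistent n α = ∀ N → ∃[ β ] (Agree n α β × (∀ e → e < N → P e β))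

    update : (ℕ → Bool) → ℕ → Bool → ℕ → Bool
    update α n b i with i ≟ n
    ... | yes _ = b
    ... | no _  = α i

    update-agree : ∀ n α b → Agree n α (update α n b)
    update-agree n α b i i<n with i ≟ n
    ... | yes refl = contradiction i<n (<-irrefl refl)
    ... | no _     = refl

    update-extends : ∀ n {α β b} → Agree n α β → β n ≡ b → Agree (suc n) (update α n b) β
    update-extends n α≈β refl i i<1+n with i ≟ n
    ... | yes refl = refl
    ... | no i≢n   = α≈β i (≤∧≢⇒< (s≤s⁻¹ i<1+n) i≢n)

    extend : ∀ n α → Consistent n α → ∃[ β ] (Consistent (suc n) β × Agree n α β)
    extend n α consistent with lem {Consistent (suc n) (update α n true)}
    ... | yes true-consistent = _ , true-consistent , update-agree n α true
    ... | no ¬true-consistent = update α n false , false-consistent , update-agree n α false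
      where
      false-consistent : Consistent (suc n) (update α n false)
      false-consistent N with lem {∃[ β ] (Agree (suc n) (update α n false) β × (∀ e → e < N → P e β))}
      ... | yes witness = witness
      -- If no extension with bit false meets the first N conditions, then any β meeting the first N
      -- + N′ has bit true at n, which makes the prefix with true consistent.
      ... | no ¬witness = contradiction (λ N′ → true-witness N′ (consistent (N + N′))) ¬true-consistent
        where
        true-witness : ∀ N′ → ∃[ β ] (Agree n α β × (∀ e → e < N + N′ → P e β)) →
                       ∃[ β ] (Agree (suc n) (update α n true) β × (∀ e → e < N′ → P e β))
        true-witness N′ (β , α≈β , Pβ) with β n in eq
        ... | true  = β , update-extends n α≈β eq , λ e e<N′ → Pβ e (≤-trans e<N′ (m≤n+m N′ N))
        ... | false = contradiction
          (β , update-extends n α≈β eq , λ e e<N → Pβ e (≤-trans e<N (m≤m+n N N′))) ¬witness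

    prefixes : ∀ n → ∃ (Consistent n)
    prefixes zero    = (λ _ → false) , λ N → proj₁ (finitely-satisfiable N) , (λ _ ()) , proj₂ (finitely-satisfiable N)
    prefixes (suc n) = let α , consistent = prefixes n ; β , β-consistent , _ = extend n α consistent in β , β-consistent

    limit : ℕ → Bool
    limit i = proj₁ (prefixes (suc i)) i

    prefixes-agree : ∀ n → Agree n (proj₁ (prefixes n)) limit
    prefixes-agree (suc n) i i<1+n with m≤n⇒m<n∨m≡n (s≤s⁻¹ i<1+n)
    ... | inj₂ refl = refl
    ... | inj₁ i<n  = trans
      (sym (proj₂ (proj₂ (extend n (proj₁ (prefixes n)) (proj₂ (prefixes n)))) i i<n))
      (prefixes-agree n i i<n)

  satisfiable : ∃[ α ] (∀ e → P e α)
  satisfiable = limit , λ e →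
    -- The prefix is long enough to settle condition e, and `suc e` makes β satisfy that condition.
    let β , α≈β , Pβ = proj₂ (prefixes (modulus e)) (suc e)
    in local e (λ i i< → trans (sym (α≈β i i<)) (prefixes-agree (modulus e) i i<)) (Pβ e ≤-refl)

-- Propositional assignments

-- Lengths are compared too, so symbols with the same index but different arities never share an
-- atom.
⌜⌝ᵥ-injective : ∀ {v : Vec ℕ m} {w : Vec ℕ n} → ⌜ v ⌝ᵥ ≡ ⌜ w ⌝ᵥ → _≡_ {A = ∃ (Vec ℕ)} (m , v) (n , w)
⌜⌝ᵥ-injective {v = []}    {[]}    _ = refl
⌜⌝ᵥ-injective {v = x ∷ v} {y ∷ w} eq
  with refl , eq′ ← ⟨⟩-injective {x} {⌜ v ⌝ᵥ} {y} {⌜ w ⌝ᵥ} (suc-injective eq)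
  with refl ← ⌜⌝ᵥ-injective {v = v} {w} eq′ = refl

Represents : (ℕ → Bool) → Interpretation → Set
Represents α I = ∀ {r} i (v : Vec ℕ r) →
  (α ⟨ i , ⌜ v ⌝ᵥ ⟩ ≡ true → I r i v) × (α ⟨ i , ⌜ v ⌝ᵥ ⟩ ≡ false → ¬ I r i v)

interpretation : (ℕ → Bool) → Interpretation
interpretation α r i v = α ⟨ i , ⌜ v ⌝ᵥ ⟩ ≡ true

represents-interpretation : ∀ α → Represents α (interpretation α)
represents-interpretation α i v = (λ eq → eq) , λ eq eq′ → contradiction (trans (sym eq) eq′) λ ()

-- Excluded middle decides whether some true atom has a given code; by injectivity at most one atom
-- has it.
representable : ExcludedMiddle 0ℓ → ∀ I → ∃[ α ] Represents α I
representable lem I = (λ a → does (lem {Holds a})) , represents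
  where
  Holds : ℕ → Set
  Holds a = ∃[ r ] ∃[ i ] ∃[ v ] (a ≡ ⟨ i , ⌜ v ⌝ᵥ ⟩ × I r i v)

  represents : Represents (λ a → does (lem {Holds a})) I
  represents i v with lem {Holds ⟨ i , ⌜ v ⌝ᵥ ⟩}
  ... | no ¬holds = (λ ()) , λ _ Iv → ¬holds (_ , i , v , refl , Iv)
  ... | yes (r , j , w , eq , Iw)
    with refl , eq′ ← ⟨⟩-injective {i} {⌜ v ⌝ᵥ} {j} {⌜ w ⌝ᵥ} eq
    with refl ← ⌜⌝ᵥ-injective {v = v} {w} eq′ = (λ _ → Iw) , λ ()

-- Finite assignments and environments as numbers

bit : Bool → ℕ
bit b = if b then 1 else 0

assignment : (ℕ → Bool) → ℕ → ℕ
assignment α M = list (tabulate {n = M} (λ i → bit (α (toℕ i))))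

at-assignment : ∀ α {M a} → a < M → at (assignment α M) a ≡ bit (α a)
at-assignment α {M} {a} a<M = begin
  at (assignment α M) a          ≡⟨ cong (at (assignment α M)) (toℕ-fromℕ< a<M) ⟨
  at (assignment α M) (toℕ i)    ≡⟨ at-list (tabulate (λ i → bit (α (toℕ i)))) i ⟩
  lookup (tabulate (λ i → bit (α (toℕ i)))) i ≡⟨ lookup∘tabulate (λ i → bit (α (toℕ i))) i ⟩
  bit (α (toℕ i))                ≡⟨ cong (bit ∘ α) (toℕ-fromℕ< a<M) ⟩
  bit (α a)                      ∎
  where
  open ≡-Reasoning
  i : Fin M
  i = fromℕ< a<M

-- The list of M ones, which by monotonicity of pairing bounds every list of M bits. Other numbers
-- below it are harmless: `decode` reads any number as an assignment.
maxAssignment : ℕ → ℕ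
maxAssignment zero    = 0
maxAssignment (suc M) = ⟨ 1 , maxAssignment M ⟩

assignment≤ : ∀ α M → assignment α M ≤ maxAssignment M
assignment≤ α zero    = z≤n
assignment≤ α (suc M) = ⟨⟩-mono-≤ {bit (α 0)} {assignment (α ∘ suc) M} (bit≤1 (α 0)) (assignment≤ (α ∘ suc) M)
  where
  bit≤1 : ∀ b → bit b ≤ 1
  bit≤1 false = z≤n
  bit≤1 true  = ≤-refl

-- Two sequences, so that one and the same assignment can serve interpretations that differ beyond
-- M.
assignment-agrees : ∀ {α β I} M → Represents β I → Agree M α β → Agrees I (assignment α M) M
assignment-agrees {α} {β} M represents α≈β i v a<M
  rewrite at-assignment α a<M | α≈β ⟨ i , ⌜ v ⌝ᵥ ⟩ a<M with β ⟨ i , ⌜ v ⌝ᵥ ⟩ | represents i v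
... | true  | I-true , _  = (λ ()) , λ _ → I-true refl
... | false | _ , I-false = (λ _ → I-false refl) , λ 0≢0 → contradiction refl 0≢0

decode : ℕ → ℕ → Bool
decode V a = not (at V a ≡ᵇ 0)

decode-agrees : ∀ V M → Agrees (interpretation (decode V)) V M
decode-agrees V M i v _ with at V ⟨ i , ⌜ v ⌝ᵥ ⟩
... | zero  = (λ _ ()) , λ 0≢0 → contradiction refl 0≢0
... | suc _ = (λ ()) , λ _ → refl

-- Every number lists values for all n variables and every tuple is listed by some number, so e
-- enumerates the instances of the matrix.
environment : ∀ n → ℕ → Vec ℕ n
environment n e = tabulate (at e ∘ toℕ)

environment-listed : ∀ n e i → at e (toℕ i) ≡ lookup (environment n e) i
environment-listed n e i = sym (lookup∘tabulate (at e ∘ toℕ) i)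

environment-list : ∀ (ρ : Vec ℕ n) → environment n (list ρ) ≡ ρ
environment-list ρ = trans (tabulate-cong (at-list ρ)) (tabulate∘lookup ρ)

-- Universal closures

closure : ∀ n → Formula n → Sentence
closure zero    φ = φ
closure (suc n) φ = closure n (`∀ φ)

closure-universal : ∀ n {φ} → Universal φ → Universal (closure n φ)
closure-universal zero    φ-univ = φ-univ
closure-universal (suc n) φ-univ = closure-universal n (univ φ-univ)

closure-⊨ : ∀ n {I φ} → (I , [] ⊨ closure n φ) ⇔ (∀ ρ → I , ρ ⊨ φ)
closure-⊨ zero    = mk⇔ (λ { ⊨φ [] → ⊨φ }) (λ ⊨φ → ⊨φ [])
closure-⊨ (suc n) = mk⇔ (λ { ⊨φ (a ∷ ρ) → Equivalence.to (closure-⊨ n) ⊨φ ρ a })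
                        (λ ⊨φ → Equivalence.from (closure-⊨ n) λ ρ a → ⊨φ (a ∷ ρ))

-- Stated for open formulas so that each quantifier peeled off is absorbed by the closure; for n = 0
-- the left side is φ itself.
universal-matrix : ∀ {φ} → Universal {n} φ → ∃[ m ] ∃[ ψ ] (QuantifierFree {m} ψ × closure n φ ≡ closure m ψ)
universal-matrix (matrix φ-qf) = _ , _ , φ-qf , refl
universal-matrix (univ φ-univ) = universal-matrix φ-univ

quantify : ℕ → ℕ → ℕ
quantify zero    c = c
quantify (suc n) c = ⟨ 8 , quantify n c ⟩

quantify-recursive : Recursive 2 (λ xs → quantify (lookup xs 0F) (lookup xs 1F))
quantify-recursive = recursion (arg 0F) (app ⟨⟩-recursive (const 8 ∷ arg 1F ∷ [])) (λ _ → refl) (λ _ _ → refl)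

-- `closure` adds quantifiers from the inside and `quantify` from the outside; the two orders agree
-- because all the added tags are equal.
⌜closure⌝ : ∀ n φ → ⌜ closure n φ ⌝ ≡ quantify n ⌜ φ ⌝
⌜closure⌝ zero    φ = refl
⌜closure⌝ (suc n) φ = trans (⌜closure⌝ n (`∀ φ)) (quantify-⟨8,⟩ n)
  where
  quantify-⟨8,⟩ : ∀ n {c} → quantify n ⟨ 8 , c ⟩ ≡ ⟨ 8 , quantify n c ⟩
  quantify-⟨8,⟩ zero    = refl
  quantify-⟨8,⟩ (suc n) = cong ⟨ 8 ,_⟩ (quantify-⟨8,⟩ n)

-- Refutation by finitely many instances

Refutes : (M n c : ℕ) → Set
Refutes M n c = ∀ V → V ≤ maxAssignment M → ∃[ e ] (e < M × formulaValue c n e V M ≡ 1)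

module _ (lem : ExcludedMiddle 0ℓ) {φ : Formula n} (φ-qf : QuantifierFree φ) where

  -- The restriction of a supposed model to the codes below M is among the assignments tested, and
  -- the instance it falsifies would be false in the model.
  refutation-sound : ∀ M → Refutes M n ⌜ φ ⌝ → Unsatisfiable (closure n φ)
  refutation-sound M refutes (I , ⊨φ)
    with α , represents ← representable lem I
    with e , _ , value≡1 ← refutes (assignment α M) (assignment≤ α M)
    with false ¬⊨φ ← subst (Verdict _ _) value≡1
           (verdict I (assignment-agrees {α} M represents λ _ _ → refl) (environment n e) (environment-listed n e) φ-qf)
    = ¬⊨φ (Equivalence.to (closure-⊨ n) ⊨φ (environment n e))

  private
    Holds : ℕ → (ℕ → Bool) → Set
    Holds e α = interpretation α , environment n e ⊨ φ

    modulus : ℕ → ℕ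
    modulus e = bound φ (environment n e)

    Verdict-unique : ∀ {D P Q w} → Verdict D P w → Verdict D Q w → D → P → Q
    Verdict-unique (undetermined ¬d) _        d _ = contradiction d ¬d
    Verdict-unique (false ¬p)        _        _ p = contradiction p ¬p
    Verdict-unique (true _)          (true q) _ _ = q

    -- Both interpretations agree with one finite assignment, so the same computed value decides the
    -- instance in both.
    local : ∀ e {α β} → Agree (modulus e) α β → Holds e α → Holds e β
    local e {α} {β} α≈β = Verdict-unique (verdict-at {α} (λ _ _ → refl)) (verdict-at {β} α≈β) ≤-refl
      where
      verdict-at : ∀ {β} → Agree (modulus e) α β → Verdict (modulus e ≤ modulus e) (Holds e β)
                   (formulaValue ⌜ φ ⌝ n e (assignment α (modulus e)) (modulus e))
      verdict-at {β} α≈β = verdict (interpretation β)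
        (assignment-agrees {α} (modulus e) (represents-interpretation β) α≈β)
        (environment n e) (environment-listed n e) φ-qf

  -- If no M refutes, each M has an assignment falsifying none of the first M instances, and
  -- compactness assembles these into a model.
  refutation-complete : Unsatisfiable (closure n φ) → ∃[ M ] Refutes M n ⌜ φ ⌝
  refutation-complete unsatisfiable with lem {∃[ M ] Refutes M n ⌜ φ ⌝}
  ... | yes refuted = refuted
  ... | no ¬refuted = contradiction (interpretation α , Equivalence.from (closure-⊨ n) λ ρ →
          subst (interpretation α ,_⊨ φ) (environment-list ρ) (⊨φ (list ρ))) unsatisfiable
    where
    unrefuted : ∀ M → ∃[ V ] (∀ e → e < M → formulaValue ⌜ φ ⌝ n e V M ≢ 1)
    unrefuted M with lem {∃[ V ] (∀ e → e < M → formulaValue ⌜ φ ⌝ n e V M ≢ 1)}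
    ... | yes V = V
    ... | no ¬V = contradiction (M , λ V _ → refuted V) ¬refuted
      where
      refuted : ∀ V → ∃[ e ] (e < M × formulaValue ⌜ φ ⌝ n e V M ≡ 1)
      refuted V with lem {∃[ e ] (e < M × formulaValue ⌜ φ ⌝ n e V M ≡ 1)}
      ... | yes e = e
      ... | no ¬e = contradiction (V , λ e e<M value≡1 → ¬e (e , e<M , value≡1)) ¬V

    finitely-satisfiable : ∀ N → ∃[ α ] (∀ e → e < N → Holds e α)
    finitely-satisfiable N = decode V , λ e e<N →
      holds e (≤-trans e<N (m≤m+n N _)) (≤-trans (≤∑< N e e<N) (m≤n+m _ N))
      where
      M V : ℕ
      -- Large enough to test the first N instances and to leave none of them undetermined; not
      -- being false, they are then true.
      M = N + ∑< N modulus
      V = proj₁ (unrefuted M)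

      ≤∑< : ∀ N e → e < N → modulus e ≤ ∑< N modulus
      ≤∑< (suc N) e e<1+N with m≤n⇒m<n∨m≡n (s≤s⁻¹ e<1+N)
      ... | inj₁ e<N  = ≤-trans (≤∑< N e e<N) (m≤n+m _ (modulus N))
      ... | inj₂ refl = m≤m+n (modulus N) _

      holds : ∀ e → e < M → modulus e ≤ M → Holds e (decode V)
      holds e e<M modulus≤M with formulaValue ⌜ φ ⌝ n e V M | proj₂ (unrefuted M) e e<M |
        verdict (interpretation (decode V)) (decode-agrees V M) (environment n e) (environment-listed n e) φ-qf
      ... | _ | _   | undetermined modulus≰M = contradiction modulus≤M modulus≰M
      ... | _ | 1≢1 | false _ = contradiction refl 1≢1
      ... | _ | _   | true ⊨φ = ⊨φ

    α : ℕ → Bool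
    α = proj₁ (Compactness.satisfiable lem Holds modulus local finitely-satisfiable)

    ⊨φ : ∀ e → Holds e α
    ⊨φ = proj₂ (Compactness.satisfiable lem Holds modulus local finitely-satisfiable)

-- The search for refutations

isFalse : ℕ → ℕ
isFalse = choose (0 ∷ 1 ∷ [])

unfalsified : (M n c V : ℕ) → ℕ
unfalsified M n c V = ifz (∑< M λ e → isFalse (formulaValue c n e V M)) 1 0

-- The sum acts as a conjunction: the two differences vanish iff x is c under n quantifiers, the
-- rest iff every assignment is refuted.
check : (M n c x : ℕ) → ℕ
check M n c x = ((quantify n c ∸ x) + (x ∸ quantify n c)) + ∑< (suc (maxAssignment M)) (unfalsified M n c)

check-recursive : Recursive 2 (λ xs → check (π₁ (lookup xs 0F)) (left (lookup xs 0F)) (right (lookup xs 0F)) (lookup xs 1F))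
check-recursive = app check₄-recursive
  (app π₁-recursive (arg 0F ∷ []) ∷ app left-recursive (arg 0F ∷ []) ∷ app right-recursive (arg 0F ∷ []) ∷ arg 1F ∷ [])
  where
  maxAssignment-recursive : Recursive 1 (λ xs → maxAssignment (lookup xs 0F))
  maxAssignment-recursive = recursion (const 0) (app ⟨⟩-recursive (const 1 ∷ arg 1F ∷ [])) (λ _ → refl) (λ _ _ → refl)

  isFalse-recursive : Recursive 5 (λ xs → isFalse
    (formulaValue (lookup xs 4F) (lookup xs 3F) (lookup xs 0F) (lookup xs 1F) (lookup xs 2F)))
  isFalse-recursive = choose-recursive (const 0 ∷ const 1 ∷ [])
    (app formulaValue-recursive (arg 4F ∷ arg 3F ∷ arg 0F ∷ arg 1F ∷ arg 2F ∷ []))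

  unfalsified-recursive : Recursive 4 (λ xs → unfalsified (lookup xs 1F) (lookup xs 2F) (lookup xs 3F) (lookup xs 0F))
  unfalsified-recursive = app ifz-recursive
    (app (∑<-recursive isFalse-recursive) (arg 1F ∷ arg 0F ∷ arg 1F ∷ arg 2F ∷ arg 3F ∷ []) ∷ const 1 ∷ const 0 ∷ [])

  check₄-recursive : Recursive 4 (λ xs → check (lookup xs 0F) (lookup xs 1F) (lookup xs 2F) (lookup xs 3F))
  check₄-recursive = app +-recursive
    ( app +-recursive (app ∸-recursive (q ∷ arg 3F ∷ []) ∷ app ∸-recursive (arg 3F ∷ q ∷ []) ∷ [])
    ∷ app (∑<-recursive unfalsified-recursive)
        (app suc-recursive (app maxAssignment-recursive (arg 0F ∷ []) ∷ []) ∷ arg 0F ∷ arg 1F ∷ arg 2F ∷ [])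
    ∷ [])
    where
    q : Recursive 4 (λ xs → quantify (lookup xs 1F) (lookup xs 2F))
    q = app quantify-recursive (arg 1F ∷ arg 2F ∷ [])

check≡0 : ∀ {M n c} → Refutes M n c → check M n c (quantify n c) ≡ 0
check≡0 {M} {n} {c} refutes
  rewrite n∸n≡0 (quantify n c) = ∑<≡0 (suc (maxAssignment M)) falsified
  where
  falsified : ∀ V → V < suc (maxAssignment M) → unfalsified M n c V ≡ 0
  falsified V V<1+max
    with ∑< M (λ e → isFalse (formulaValue c n e V M)) in eq | refutes V (s≤s⁻¹ V<1+max)
  ... | suc _ | _ = refl
  ... | zero  | e , e<M , value≡1 =
    contradiction (trans (sym (cong isFalse value≡1)) (∑<≡0⁻¹ M eq e e<M)) λ ()

check≡0⁻¹ : ∀ {M n c x} → check M n c x ≡ 0 → x ≡ quantify n c × Refutes M n c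
check≡0⁻¹ {M} {n} {c} {x} eq = x≡ , refutes
  where
  x≡ : x ≡ quantify n c
  x≡ = ≤-antisym (m∸n≡0⇒m≤n (m+n≡0⇒n≡0 (quantify n c ∸ x) (m+n≡0⇒m≡0 _ eq)))
                 (m∸n≡0⇒m≤n (m+n≡0⇒m≡0 (quantify n c ∸ x) (m+n≡0⇒m≡0 _ eq)))

  falsifying : ∀ V N → ∑< N (λ e → isFalse (formulaValue c n e V M)) ≢ 0 →
               ∃[ e ] (e < N × formulaValue c n e V M ≡ 1)
  falsifying V zero    ≢0 = contradiction refl ≢0
  falsifying V (suc N) ≢0 with formulaValue c n N V M in value
  ... | 1           = N , ≤-refl , value
  ... | zero        = let e , e<N , value≡1 = falsifying V N ≢0 in e , m≤n⇒m≤1+n e<N , value≡1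
  ... | suc (suc _) = let e , e<N , value≡1 = falsifying V N ≢0 in e , m≤n⇒m≤1+n e<N , value≡1

  refutes : Refutes M n c
  refutes V V≤max = falsifying V M λ ∑≡0 → contradiction
    (trans (sym (cong (λ s → ifz s 1 0) ∑≡0))
      (∑<≡0⁻¹ (suc (maxAssignment M)) (m+n≡0⇒n≡0 ((quantify n c ∸ x) + (x ∸ quantify n c)) eq) V (s≤s V≤max)))
    λ ()

recursively-enumerable : ExcludedMiddle 0ℓ → Σ⁰₁ UnsatisfiableUniversal
recursively-enumerable lem = mu (code check-recursive) , λ x → mk⇔
  (λ unsat → Equivalence.to (search⇓ check-recursive) (certificate x unsat))
  (λ halts → let w , eq = Equivalence.from (search⇓ check-recursive) halts in
    certified x (π₁ w) (left w) (right w) eq)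
  where
  certificate : ∀ x → UnsatisfiableUniversal x → ∃[ w ] check (π₁ w) (left w) (right w) x ≡ 0
  certificate _ (φ , refl , φ-univ , unsatisfiable)
    with n , ψ , ψ-qf , φ≡ ← universal-matrix φ-univ
    with M , refutes ← refutation-complete lem ψ-qf (subst Unsatisfiable φ≡ unsatisfiable)
    = ⟨ M , ⟨ n , ⌜ ψ ⌝ ⟩ ⟩ , eq
    where
    eq : check (π₁ ⟨ M , ⟨ n , ⌜ ψ ⌝ ⟩ ⟩) (left ⟨ M , ⟨ n , ⌜ ψ ⌝ ⟩ ⟩) (right ⟨ M , ⟨ n , ⌜ ψ ⌝ ⟩ ⟩) ⌜ φ ⌝ ≡ 0
    eq rewrite π₁-⟨⟩ M ⟨ n , ⌜ ψ ⌝ ⟩ | π₂-⟨⟩ M ⟨ n , ⌜ ψ ⌝ ⟩ | π₁-⟨⟩ n ⌜ ψ ⌝ | π₂-⟨⟩ n ⌜ ψ ⌝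
      | φ≡ | ⌜closure⌝ n ψ = check≡0 refutes

  certified : ∀ x M n c → check M n c x ≡ 0 → UnsatisfiableUniversal x
  certified x M n c eq
    with refl , refutes ← check≡0⁻¹ {M} {n} {c} {x} eq
    -- The assignment 0 is always in range; the value 1 it yields is nonzero, hence c can be parsed.
    with e , _ , value≡1 ← refutes 0 z≤n
    with φ , φ-qf , refl ← parse-formula {n} c (<-wellFounded c)
      (λ value≡0 → contradiction (trans (sym value≡0) value≡1) λ ())
    = closure n φ , sym (⌜closure⌝ n φ) , closure-universal n (matrix φ-qf) , refutation-sound lem φ-qf M refutes

-- Injectivity of the Gödel numbering

tagₜ bodyₜ : Term n → ℕ
tagₜ (var _)  = 0
tagₜ `0       = 1
tagₜ `1       = 2
tagₜ (_ `+ _) = 3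
bodyₜ (var x)  = toℕ x
bodyₜ `0       = 0
bodyₜ `1       = 0
bodyₜ (s `+ t) = ⟨ ⌜ s ⌝ₜ , ⌜ t ⌝ₜ ⟩

⌜⌝ₜ≡⟨tag,body⟩ : ∀ (t : Term n) → ⌜ t ⌝ₜ ≡ ⟨ tagₜ t , bodyₜ t ⟩
⌜⌝ₜ≡⟨tag,body⟩ (var _)  = refl
⌜⌝ₜ≡⟨tag,body⟩ `0       = refl
⌜⌝ₜ≡⟨tag,body⟩ `1       = refl
⌜⌝ₜ≡⟨tag,body⟩ (_ `+ _) = refl

-- Once tags and bodies are separated, distinct tags rule out all cases with different constructors.
⌜⌝ₜ-injective : ∀ (s t : Term n) → ⌜ s ⌝ₜ ≡ ⌜ t ⌝ₜ → s ≡ t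
⌜⌝ₜ-injective s t eq =
  let tag≡ , body≡ = ⟨⟩-injective {tagₜ s} {bodyₜ s} {tagₜ t} {bodyₜ t}
        (trans (sym (⌜⌝ₜ≡⟨tag,body⟩ s)) (trans eq (⌜⌝ₜ≡⟨tag,body⟩ t)))
  in by-tag s t tag≡ body≡
  where
  by-tag : ∀ (s t : Term n) → tagₜ s ≡ tagₜ t → bodyₜ s ≡ bodyₜ t → s ≡ t
  by-tag (var x)  (var y)    refl eq = cong var (toℕ-injective eq)
  by-tag `0       `0         refl _  = refl
  by-tag `1       `1         refl _  = refl
  by-tag (s `+ t) (s′ `+ t′) refl eq =
    let s≡ , t≡ = ⟨⟩-injective {⌜ s ⌝ₜ} {⌜ t ⌝ₜ} {⌜ s′ ⌝ₜ} {⌜ t′ ⌝ₜ} eq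
    in cong₂ _`+_ (⌜⌝ₜ-injective s s′ s≡) (⌜⌝ₜ-injective t t′ t≡)

⌜⌝ₜₛ-injective : ∀ {q} (ss : Vec (Term n) q) (ts : Vec (Term n) r) → ⌜ ss ⌝ₜₛ ≡ ⌜ ts ⌝ₜₛ →
                 _≡_ {A = ∃ (Vec (Term n))} (q , ss) (r , ts)
⌜⌝ₜₛ-injective []       []       _  = refl
⌜⌝ₜₛ-injective (s ∷ ss) (t ∷ ts) eq
  with s≡ , ss≡ ← ⟨⟩-injective {⌜ s ⌝ₜ} {⌜ ss ⌝ₜₛ} {⌜ t ⌝ₜ} {⌜ ts ⌝ₜₛ} (suc-injective eq)
  with refl ← ⌜⌝ₜ-injective s t s≡ | refl ← ⌜⌝ₜₛ-injective ss ts ss≡ = refl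

tag-of body-of : Formula n → ℕ
tag-of (_ `= _)   = 0
tag-of (_ `≤ _)   = 1
tag-of (_ `< _)   = 2
tag-of (pred _ _) = 3
tag-of (`¬ _)     = 4
tag-of (_ `∧ _)   = 5
tag-of (_ `∨ _)   = 6
tag-of (_ `→ _)   = 7
tag-of (`∀ _)     = 8
tag-of (`∃ _)     = 9
body-of (s `= t)    = ⟨ ⌜ s ⌝ₜ , ⌜ t ⌝ₜ ⟩
body-of (s `≤ t)    = ⟨ ⌜ s ⌝ₜ , ⌜ t ⌝ₜ ⟩
body-of (s `< t)    = ⟨ ⌜ s ⌝ₜ , ⌜ t ⌝ₜ ⟩
body-of (pred i ts) = ⟨ i , ⌜ ts ⌝ₜₛ ⟩
body-of (`¬ φ)      = ⌜ φ ⌝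
body-of (φ `∧ ψ)    = ⟨ ⌜ φ ⌝ , ⌜ ψ ⌝ ⟩
body-of (φ `∨ ψ)    = ⟨ ⌜ φ ⌝ , ⌜ ψ ⌝ ⟩
body-of (φ `→ ψ)    = ⟨ ⌜ φ ⌝ , ⌜ ψ ⌝ ⟩
body-of (`∀ φ)      = ⌜ φ ⌝
body-of (`∃ φ)      = ⌜ φ ⌝

⌜⌝≡⟨tag,body⟩ : ∀ (φ : Formula n) → ⌜ φ ⌝ ≡ ⟨ tag-of φ , body-of φ ⟩
⌜⌝≡⟨tag,body⟩ (_ `= _)   = refl
⌜⌝≡⟨tag,body⟩ (_ `≤ _)   = refl
⌜⌝≡⟨tag,body⟩ (_ `< _)   = refl
⌜⌝≡⟨tag,body⟩ (pred _ _) = refl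
⌜⌝≡⟨tag,body⟩ (`¬ _)     = refl
⌜⌝≡⟨tag,body⟩ (_ `∧ _)   = refl
⌜⌝≡⟨tag,body⟩ (_ `∨ _)   = refl
⌜⌝≡⟨tag,body⟩ (_ `→ _)   = refl
⌜⌝≡⟨tag,body⟩ (`∀ _)     = refl
⌜⌝≡⟨tag,body⟩ (`∃ _)     = refl

⌜⌝-injective : ∀ (φ ψ : Formula n) → ⌜ φ ⌝ ≡ ⌜ ψ ⌝ → φ ≡ ψ
⌜⌝-injective φ ψ eq =
  let tag≡ , body≡ = ⟨⟩-injective {tag-of φ} {body-of φ} {tag-of ψ} {body-of ψ}
        (trans (sym (⌜⌝≡⟨tag,body⟩ φ)) (trans eq (⌜⌝≡⟨tag,body⟩ ψ)))
  in by-tag φ ψ tag≡ body≡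
  where
  terms : ∀ (s t s′ t′ : Term n) → ⟨ ⌜ s ⌝ₜ , ⌜ t ⌝ₜ ⟩ ≡ ⟨ ⌜ s′ ⌝ₜ , ⌜ t′ ⌝ₜ ⟩ → s ≡ s′ × t ≡ t′
  terms s t s′ t′ eq =
    let s≡ , t≡ = ⟨⟩-injective {⌜ s ⌝ₜ} {⌜ t ⌝ₜ} {⌜ s′ ⌝ₜ} {⌜ t′ ⌝ₜ} eq
    in ⌜⌝ₜ-injective s s′ s≡ , ⌜⌝ₜ-injective t t′ t≡

  formulas : ∀ (φ ψ φ′ ψ′ : Formula n) → ⟨ ⌜ φ ⌝ , ⌜ ψ ⌝ ⟩ ≡ ⟨ ⌜ φ′ ⌝ , ⌜ ψ′ ⌝ ⟩ → φ ≡ φ′ × ψ ≡ ψ′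
  formulas φ ψ φ′ ψ′ eq =
    let φ≡ , ψ≡ = ⟨⟩-injective {⌜ φ ⌝} {⌜ ψ ⌝} {⌜ φ′ ⌝} {⌜ ψ′ ⌝} eq
    in ⌜⌝-injective φ φ′ φ≡ , ⌜⌝-injective ψ ψ′ ψ≡

  by-tag : ∀ (φ ψ : Formula n) → tag-of φ ≡ tag-of ψ → body-of φ ≡ body-of ψ → φ ≡ ψ
  by-tag (s `= t) (s′ `= t′) refl eq with refl , refl ← terms s t s′ t′ eq = refl
  by-tag (s `≤ t) (s′ `≤ t′) refl eq with refl , refl ← terms s t s′ t′ eq = refl
  by-tag (s `< t) (s′ `< t′) refl eq with refl , refl ← terms s t s′ t′ eq = refl
  by-tag (pred i ss) (pred j ts) refl eq
    with refl , ss≡ ← ⟨⟩-injective {i} {⌜ ss ⌝ₜₛ} {j} {⌜ ts ⌝ₜₛ} eq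
    with refl ← ⌜⌝ₜₛ-injective ss ts ss≡ = refl
  by-tag (`¬ φ) (`¬ ψ) refl eq = cong `¬_ (⌜⌝-injective φ ψ eq)
  by-tag (φ `∧ ψ) (φ′ `∧ ψ′) refl eq with refl , refl ← formulas φ ψ φ′ ψ′ eq = refl
  by-tag (φ `∨ ψ) (φ′ `∨ ψ′) refl eq with refl , refl ← formulas φ ψ φ′ ψ′ eq = refl
  by-tag (φ `→ ψ) (φ′ `→ ψ′) refl eq with refl , refl ← formulas φ ψ φ′ ψ′ eq = refl
  by-tag (`∀ φ) (`∀ ψ) refl eq = cong `∀_ (⌜⌝-injective φ ψ eq)
  by-tag (`∃ φ) (`∃ ψ) refl eq = cong `∃_ (⌜⌝-injective φ ψ eq)

-- Gödel numbers of programs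

mutual

  ⌜_⌝ᵣ : Rec n → ℕ
  ⌜ f ⌝ᵣ = ⟨ tagᵣ f , bodyᵣ f ⟩

  ⌜_⌝ᵣₛ : Vec (Rec n) m → ℕ
  ⌜ []     ⌝ᵣₛ = 0
  ⌜ f ∷ fs ⌝ᵣₛ = ⟨ ⌜ f ⌝ᵣ , ⌜ fs ⌝ᵣₛ ⟩

  tagᵣ bodyᵣ : Rec n → ℕ
  tagᵣ zero       = 0
  tagᵣ succ       = 1
  tagᵣ (proj _)   = 2
  tagᵣ (comp _ _) = 3
  tagᵣ (prec _ _) = 4
  tagᵣ (mu _)     = 5
  bodyᵣ zero               = 0
  bodyᵣ succ               = 0
  bodyᵣ (proj i)           = toℕ i
  -- The inner arity is invisible in the type `Rec n`, so it is recorded; it fixes the length of gs,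
  -- whose code therefore needs no end marker.
  bodyᵣ (comp {m = m} f gs) = ⟨ m , ⟨ ⌜ f ⌝ᵣ , ⌜ gs ⌝ᵣₛ ⟩ ⟩
  bodyᵣ (prec f g)         = ⟨ ⌜ f ⌝ᵣ , ⌜ g ⌝ᵣ ⟩
  bodyᵣ (mu f)             = ⌜ f ⌝ᵣ

mutual

  ⌜⌝ᵣ-injective : ∀ (f g : Rec n) → ⌜ f ⌝ᵣ ≡ ⌜ g ⌝ᵣ → f ≡ g
  ⌜⌝ᵣ-injective f g eq = let tag≡ , body≡ = ⟨⟩-injective {tagᵣ f} {bodyᵣ f} {tagᵣ g} {bodyᵣ g} eq in by-tag f g tag≡ body≡

  ⌜⌝ᵣₛ-injective : ∀ (fs gs : Vec (Rec n) m) → ⌜ fs ⌝ᵣₛ ≡ ⌜ gs ⌝ᵣₛ → fs ≡ gs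
  ⌜⌝ᵣₛ-injective []       []       _  = refl
  ⌜⌝ᵣₛ-injective (f ∷ fs) (g ∷ gs) eq =
    let f≡ , fs≡ = ⟨⟩-injective {⌜ f ⌝ᵣ} {⌜ fs ⌝ᵣₛ} {⌜ g ⌝ᵣ} {⌜ gs ⌝ᵣₛ} eq
    in cong₂ _∷_ (⌜⌝ᵣ-injective f g f≡) (⌜⌝ᵣₛ-injective fs gs fs≡)

  private
    by-tag : ∀ (f g : Rec n) → tagᵣ f ≡ tagᵣ g → bodyᵣ f ≡ bodyᵣ g → f ≡ g
    by-tag zero     zero     refl _  = refl
    by-tag succ     succ     refl _  = refl
    by-tag (proj i) (proj j) refl eq = cong proj (toℕ-injective eq)
    by-tag (comp {m = m} f fs) (comp {m = m′} g gs) refl eq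
      with refl , eq′ ← ⟨⟩-injective {m} {⟨ ⌜ f ⌝ᵣ , ⌜ fs ⌝ᵣₛ ⟩} {m′} {⟨ ⌜ g ⌝ᵣ , ⌜ gs ⌝ᵣₛ ⟩} eq
      with f≡ , fs≡ ← ⟨⟩-injective {⌜ f ⌝ᵣ} {⌜ fs ⌝ᵣₛ} {⌜ g ⌝ᵣ} {⌜ gs ⌝ᵣₛ} eq′ =
      cong₂ comp (⌜⌝ᵣ-injective f g f≡) (⌜⌝ᵣₛ-injective fs gs fs≡)
    by-tag (prec f f′) (prec g g′) refl eq =
      let f≡ , f′≡ = ⟨⟩-injective {⌜ f ⌝ᵣ} {⌜ f′ ⌝ᵣ} {⌜ g ⌝ᵣ} {⌜ g′ ⌝ᵣ} eq
      in cong₂ prec (⌜⌝ᵣ-injective f g f≡) (⌜⌝ᵣ-injective f′ g′ f′≡)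
    by-tag (mu f) (mu g) refl eq = cong mu (⌜⌝ᵣ-injective f g eq)

-- Quantifier-free axioms, parametrised by terms

⟦_⟧* : Vec (Term n) r → Vec ℕ n → Vec ℕ r
⟦ ts ⟧* ρ = map (λ t → ⟦ t ⟧ ρ) ts

-- Instances at arbitrary terms take the place of substitution and renaming: a conjunction just
-- splits its vector of terms. `Meaning` allows models to be handled on numbers, without syntax.
record Axiom : Set₁ where
  field
    arity    : ℕ
    instance-at : Vec (Term n) arity → Formula n
    qf       : ∀ (ts : Vec (Term n) arity) → QuantifierFree (instance-at ts)
    Meaning  : Interpretation → Vec ℕ arity → Set
    meaning  : ∀ I (ρ : Vec ℕ n) ts → (I , ρ ⊨ instance-at ts) ≡ Meaning I (⟦ ts ⟧* ρ)

open Axiom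

infix 4 _⊩_

_⊩_ : Interpretation → Axiom → Set
I ⊩ A = ∀ v → Meaning A I v

infixr 5 _&_

_&_ : Axiom → Axiom → Axiom
arity       (A & B) = arity A + arity B
instance-at (A & B) ts = instance-at A (take (arity A) ts) `∧ instance-at B (drop (arity A) ts)
qf          (A & B) ts = qf-∧ (qf A _) (qf B _)
Meaning     (A & B) I v = Meaning A I (take (arity A) v) × Meaning B I (drop (arity A) v)
meaning     (A & B) I ρ ts = cong₂ _×_
  (trans (meaning A I ρ _) (cong (Meaning A I) (sym (take-map _ (arity A) ts))))
  (trans (meaning B I ρ _) (cong (Meaning B I) (sym (drop-map _ (arity A) ts))))

&⁺ : ∀ {I A B} → I ⊩ A → I ⊩ B → I ⊩ A & B
&⁺ ⊩A ⊩B v = ⊩A _ , ⊩B _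

take-++ : ∀ (xs : Vec ℕ m) {ys : Vec ℕ n} → take m (xs ++ ys) ≡ xs
take-++ []       = refl
take-++ (x ∷ xs) = cong (x ∷_) (take-++ xs)

drop-++ : ∀ (xs : Vec ℕ m) {ys : Vec ℕ n} → drop m (xs ++ ys) ≡ ys
drop-++ []       = refl
drop-++ (x ∷ xs) = drop-++ xs

-- The two conjuncts have disjoint variables; those of the other one are filled with zeros.
&⁻ : ∀ {I} A B → I ⊩ A & B → I ⊩ A × I ⊩ B
&⁻ {I} A B ⊩A&B =
  (λ v → subst (Meaning A I) (take-++ v) (proj₁ (⊩A&B (v ++ replicate (arity B) 0)))) ,
  (λ v → subst (Meaning B I) (drop-++ (replicate (arity A) 0)) (proj₂ (⊩A&B (replicate (arity A) 0 ++ v))))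

-- The Horn axioms for the graphs of a program and its subprograms, whose
-- least model consists of the graphs themselves. For every f to be minimised
-- there is a second predicate symbol, true of k ∷ xs if f is defined and
-- positive at i ∷ xs for all i < k.

graph : Rec n → ℕ
graph f = ⟨ 0 , ⌜ f ⌝ᵣ ⟩

positive : Rec (suc n) → ℕ
positive f = ⟨ 1 , ⌜ f ⌝ᵣ ⟩

zero-axiom succ-axiom : Axiom

arity       zero-axiom = 0
instance-at zero-axiom _ = pred (graph zero) (`0 ∷ [])
qf          zero-axiom _ = qf-pred
Meaning     zero-axiom I _ = I _ (graph zero) (0 ∷ [])
meaning     zero-axiom _ _ _ = refl

arity       succ-axiom = 1
instance-at succ-axiom (x ∷ []) = pred (graph succ) ((`1 `+ x) ∷ x ∷ [])
qf          succ-axiom (_ ∷ []) = qf-pred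
Meaning     succ-axiom I (x ∷ []) = I _ (graph succ) (suc x ∷ x ∷ [])
meaning     succ-axiom _ _ (_ ∷ []) = refl

proj-axiom : Fin n → Axiom
arity       (proj-axiom {n} i) = n
instance-at (proj-axiom i) ts = pred (graph (proj i)) (lookup ts i ∷ ts)
qf          (proj-axiom i) _ = qf-pred
Meaning     (proj-axiom i) I xs = I _ (graph (proj i)) (lookup xs i ∷ xs)
meaning     (proj-axiom i) I ρ ts = cong (λ y → I _ (graph (proj i)) (y ∷ ⟦ ts ⟧* ρ)) (sym (lookup-map i _ ts))

premises : ∀ {N} → Vec (Rec n) m → Vec (Term N) m → Vec (Term N) n → Formula N → Formula N
premises []       []       xs φ = φ
premises (g ∷ gs) (y ∷ ys) xs φ = pred (graph g) (y ∷ xs) `→ premises gs ys xs φ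

Premises : Interpretation → Vec (Rec n) m → Vec ℕ m → Vec ℕ n → Set → Set
Premises I []       []       xs P = P
Premises I (g ∷ gs) (y ∷ ys) xs P = I _ (graph g) (y ∷ xs) → Premises I gs ys xs P

premises-qf : ∀ {N} (gs : Vec (Rec n) m) (ys : Vec (Term N) m) {xs φ} → QuantifierFree φ →
              QuantifierFree (premises gs ys xs φ)
premises-qf []       []       φ-qf = φ-qf
premises-qf (g ∷ gs) (y ∷ ys) φ-qf = qf-→ qf-pred (premises-qf gs ys φ-qf)

premises-meaning : ∀ {N} I (ρ : Vec ℕ N) (gs : Vec (Rec n) m) ys {xs φ} →
                   (I , ρ ⊨ premises gs ys xs φ) ≡ Premises I gs (⟦ ys ⟧* ρ) (⟦ xs ⟧* ρ) (I , ρ ⊨ φ)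
premises-meaning I ρ []       []       = refl
premises-meaning I ρ (g ∷ gs) (y ∷ ys) {xs} =
  cong (λ P → I _ (graph g) (⟦ y ⟧ ρ ∷ ⟦ xs ⟧* ρ) → P) (premises-meaning I ρ gs ys)

Premises⁺ : ∀ {I} (gs : Vec (Rec n) m) ys {xs P} →
            ((∀ i → I _ (graph (lookup gs i)) (lookup ys i ∷ xs)) → P) → Premises I gs ys xs P
Premises⁺ []       []       p = p λ ()
Premises⁺ (g ∷ gs) (y ∷ ys) p = λ gy → Premises⁺ gs ys λ gys → p λ { zero → gy ; (suc i) → gys i }

Premises⁻ : ∀ {I} (gs : Vec (Rec n) m) ys {xs P} → Premises I gs ys xs P →
            (∀ i → I _ (graph (lookup gs i)) (lookup ys i ∷ xs)) → P
Premises⁻ []       []       p gys = p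
Premises⁻ (g ∷ gs) (y ∷ ys) p gys = Premises⁻ gs ys (p (gys zero)) (gys ∘ suc)

-- The variables are the result, the m intermediate values and the n arguments, in this order.
comp-axiom : Rec m → Vec (Rec n) m → Axiom
arity       (comp-axiom {m} {n} f gs) = suc (m + n)
instance-at (comp-axiom {m} f gs) (z ∷ ts) = premises gs (take m ts) (drop m ts)
  (pred (graph f) (z ∷ take m ts) `→ pred (graph (comp f gs)) (z ∷ drop m ts))
qf          (comp-axiom {m} f gs) (z ∷ ts) = premises-qf gs (take m ts) (qf-→ qf-pred qf-pred)
Meaning     (comp-axiom {m} f gs) I (z ∷ v) = Premises I gs (take m v) (drop m v)
  (I _ (graph f) (z ∷ take m v) → I _ (graph (comp f gs)) (z ∷ drop m v))
meaning     (comp-axiom {m} f gs) I ρ (z ∷ ts) = trans (premises-meaning I ρ gs (take m ts))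
  (cong₂ (λ ys xs → Premises I gs ys xs (I _ (graph f) (⟦ z ⟧ ρ ∷ ys) → I _ (graph (comp f gs)) (⟦ z ⟧ ρ ∷ xs)))
    (sym (take-map _ m ts)) (sym (drop-map _ m ts)))

prec-zero-axiom prec-suc-axiom : Rec n → Rec (suc (suc n)) → Axiom

arity       (prec-zero-axiom {n} f g) = suc n
instance-at (prec-zero-axiom f g) (y ∷ xs) = pred (graph f) (y ∷ xs) `→ pred (graph (prec f g)) (y ∷ `0 ∷ xs)
qf          (prec-zero-axiom f g) (_ ∷ _) = qf-→ qf-pred qf-pred
Meaning     (prec-zero-axiom f g) I (y ∷ xs) = I _ (graph f) (y ∷ xs) → I _ (graph (prec f g)) (y ∷ 0 ∷ xs)
meaning     (prec-zero-axiom f g) _ _ (_ ∷ _) = refl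

arity       (prec-suc-axiom {n} f g) = suc (suc (suc n))
instance-at (prec-suc-axiom f g) (z ∷ y ∷ k ∷ xs) =
  pred (graph (prec f g)) (y ∷ k ∷ xs) `→ (pred (graph g) (z ∷ k ∷ y ∷ xs) `→
  pred (graph (prec f g)) (z ∷ (`1 `+ k) ∷ xs))
qf          (prec-suc-axiom f g) (_ ∷ _ ∷ _ ∷ _) = qf-→ qf-pred (qf-→ qf-pred qf-pred)
Meaning     (prec-suc-axiom f g) I (z ∷ y ∷ k ∷ xs) =
  I _ (graph (prec f g)) (y ∷ k ∷ xs) → I _ (graph g) (z ∷ k ∷ y ∷ xs) →
  I _ (graph (prec f g)) (z ∷ suc k ∷ xs)
meaning     (prec-suc-axiom f g) _ _ (_ ∷ _ ∷ _ ∷ _) = refl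

-- Recursion on k replaces the bounded quantifier in the rule for `mu`; the positive value `suc v`
-- is existential in a premise and so becomes a universal variable.
positive-zero-axiom positive-suc-axiom mu-axiom : Rec (suc n) → Axiom

arity       (positive-zero-axiom {n} f) = n
instance-at (positive-zero-axiom f) xs = pred (positive f) (`0 ∷ xs)
qf          (positive-zero-axiom f) _ = qf-pred
Meaning     (positive-zero-axiom f) I xs = I _ (positive f) (0 ∷ xs)
meaning     (positive-zero-axiom f) _ _ _ = refl

arity       (positive-suc-axiom {n} f) = suc (suc n)
instance-at (positive-suc-axiom f) (v ∷ k ∷ xs) =
  pred (positive f) (k ∷ xs) `→ (pred (graph f) ((`1 `+ v) ∷ k ∷ xs) `→ pred (positive f) ((`1 `+ k) ∷ xs))
qf          (positive-suc-axiom f) (_ ∷ _ ∷ _) = qf-→ qf-pred (qf-→ qf-pred qf-pred)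
Meaning     (positive-suc-axiom f) I (v ∷ k ∷ xs) =
  I _ (positive f) (k ∷ xs) → I _ (graph f) (suc v ∷ k ∷ xs) → I _ (positive f) (suc k ∷ xs)
meaning     (positive-suc-axiom f) _ _ (_ ∷ _ ∷ _) = refl

arity       (mu-axiom {n} f) = suc n
instance-at (mu-axiom f) (k ∷ xs) =
  pred (positive f) (k ∷ xs) `→ (pred (graph f) (`0 ∷ k ∷ xs) `→ pred (graph (mu f)) (k ∷ xs))
qf          (mu-axiom f) (_ ∷ _) = qf-→ qf-pred (qf-→ qf-pred qf-pred)
Meaning     (mu-axiom f) I (k ∷ xs) =
  I _ (positive f) (k ∷ xs) → I _ (graph f) (0 ∷ k ∷ xs) → I _ (graph (mu f)) (k ∷ xs)
meaning     (mu-axiom f) _ _ (_ ∷ _) = refl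

-- The axioms of a program, and the graphs as their least model

mutual

  axioms : Rec n → Axiom
  axioms zero        = zero-axiom
  axioms succ        = succ-axiom
  axioms (proj i)    = proj-axiom i
  axioms (comp f gs) = comp-axiom f gs & axioms f & axioms* gs
  axioms (prec f g)  = prec-zero-axiom f g & prec-suc-axiom f g & axioms f & axioms g
  axioms (mu f)      = positive-zero-axiom f & positive-suc-axiom f & mu-axiom f & axioms f

  axioms* : Vec (Rec n) m → Axiom
  -- For the empty vector any axiom true in `Graphs` will do.
  axioms* []       = zero-axiom
  axioms* (g ∷ gs) = axioms g & axioms* gs

axioms-lookup : ∀ {I} (gs : Vec (Rec n) m) → I ⊩ axioms* gs → ∀ i → I ⊩ axioms (lookup gs i)
axioms-lookup (g ∷ gs) ⊩gs zero    = proj₁ (&⁻ (axioms g) (axioms* gs) ⊩gs)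
axioms-lookup (g ∷ gs) ⊩gs (suc i) = axioms-lookup gs (proj₂ (&⁻ (axioms g) (axioms* gs) ⊩gs)) i

-- Every evaluation rule is matched by axioms, so induction on the computation puts the graph of f
-- into every model.
axioms-complete : ∀ {I} (f : Rec n) {xs y} → I ⊩ axioms f → f [ xs ]⇓ y → I _ (graph f) (y ∷ xs)
axioms-complete zero     ⊩f zero⇓ = ⊩f []
axioms-complete succ     ⊩f (succ⇓ {x}) = ⊩f (x ∷ [])
axioms-complete (proj i) ⊩f (proj⇓ {xs = xs}) = ⊩f xs
axioms-complete {I = I} (comp {m = m} f gs) ⊩f (comp⇓ {xs = xs} {ys} {z} gs⇓ f⇓)
  with ⊩comp , ⊩rest ← &⁻ (comp-axiom f gs) (axioms f & axioms* gs) ⊩f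
  with ⊩f , ⊩gs ← &⁻ (axioms f) (axioms* gs) ⊩rest
  = Premises⁻ gs ys
      (subst₂ (λ ys′ xs′ → Premises I gs ys′ xs′ (I _ (graph f) (z ∷ ys′) → I _ (graph (comp f gs)) (z ∷ xs′)))
        (take-++ ys) (drop-++ ys) (⊩comp (z ∷ ys ++ xs)))
      (λ i → axioms-complete (lookup gs i) (axioms-lookup gs ⊩gs i) (gs⇓ i))
      (axioms-complete f ⊩f f⇓)
axioms-complete (prec f g) {y = y} ⊩f (prec⇓-zero {xs = xs} f⇓)
  with ⊩zero , ⊩rest ← &⁻ (prec-zero-axiom f g) (prec-suc-axiom f g & axioms f & axioms g) ⊩f
  with _ , ⊩rest ← &⁻ (prec-suc-axiom f g) (axioms f & axioms g) ⊩rest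
  with ⊩f , _ ← &⁻ (axioms f) (axioms g) ⊩rest
  = ⊩zero (y ∷ xs) (axioms-complete f ⊩f f⇓)
axioms-complete (prec f g) ⊩f (prec⇓-suc {k = k} {xs} {y} {z} r⇓ g⇓)
  with _ , ⊩rest ← &⁻ (prec-zero-axiom f g) (prec-suc-axiom f g & axioms f & axioms g) ⊩f
  with ⊩suc , ⊩rest ← &⁻ (prec-suc-axiom f g) (axioms f & axioms g) ⊩rest
  with _ , ⊩g ← &⁻ (axioms f) (axioms g) ⊩rest
  = ⊩suc (z ∷ y ∷ k ∷ xs) (axioms-complete (prec f g) ⊩f r⇓) (axioms-complete g ⊩g g⇓)
axioms-complete {I = I} (mu f) {xs} ⊩f (mu⇓ {k = k} below f⇓)
  with ⊩zero , ⊩rest ← &⁻ (positive-zero-axiom f) (positive-suc-axiom f & mu-axiom f & axioms f) ⊩f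
  with ⊩suc , ⊩rest ← &⁻ (positive-suc-axiom f) (mu-axiom f & axioms f) ⊩rest
  with ⊩mu , ⊩f ← &⁻ (mu-axiom f) (axioms f) ⊩rest
  = ⊩mu (k ∷ xs) (positive-below k ≤-refl) (axioms-complete f ⊩f f⇓)
  where
  positive-below : ∀ j → j ≤ k → I _ (positive f) (j ∷ xs)
  positive-below zero    _   = ⊩zero xs
  positive-below (suc j) j<k = ⊩suc (proj₁ (below j j<k) ∷ j ∷ xs)
    (positive-below j (<⇒≤ j<k)) (axioms-complete f ⊩f (proj₂ (below j j<k)))

-- One model for all programs at once. The symbol enters through an equation because `graph f` is no
-- constructor form to match on.
data Graphs : Interpretation where
  graphs    : ∀ (f : Rec n) {i xs y} → i ≡ graph f → f [ xs ]⇓ y → Graphs (suc n) i (y ∷ xs)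
  positives : ∀ (f : Rec (suc n)) {i k xs} → i ≡ positive f → (∀ j → j < k → ∃[ v ] f [ j ∷ xs ]⇓ suc v) →
              Graphs (suc n) i (k ∷ xs)

-- The arity of the symbol fixes that of the program and injectivity of codes the program itself;
-- the tags 0 and 1 keep the two families of symbols apart.
graphs⁻ : ∀ (f : Rec n) {y xs} → Graphs (suc n) (graph f) (y ∷ xs) → f [ xs ]⇓ y
graphs⁻ f (graphs g eq g⇓)
  with refl ← ⌜⌝ᵣ-injective f g (proj₂ (⟨⟩-injective {0} {⌜ f ⌝ᵣ} {0} {⌜ g ⌝ᵣ} eq)) = g⇓
graphs⁻ f (positives g eq _) =
  contradiction (proj₁ (⟨⟩-injective {0} {⌜ f ⌝ᵣ} {1} {⌜ g ⌝ᵣ} eq)) λ ()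

positives⁻ : ∀ (f : Rec (suc n)) {k xs} → Graphs (suc n) (positive f) (k ∷ xs) →
             ∀ j → j < k → ∃[ v ] f [ j ∷ xs ]⇓ suc v
positives⁻ f (graphs g eq _) =
  contradiction (proj₁ (⟨⟩-injective {1} {⌜ f ⌝ᵣ} {0} {⌜ g ⌝ᵣ} eq)) λ ()
positives⁻ f (positives g eq below)
  with refl ← ⌜⌝ᵣ-injective f g (proj₂ (⟨⟩-injective {1} {⌜ f ⌝ᵣ} {1} {⌜ g ⌝ᵣ} eq)) = below

mutual

  -- Read in `Graphs`, each axiom is an evaluation rule or a step in extending the positive range of
  -- a function to be minimised.
  graphs-model : ∀ (f : Rec n) → Graphs ⊩ axioms f
  graphs-model zero []           = graphs zero refl zero⇓
  graphs-model succ (x ∷ [])     = graphs succ refl succ⇓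
  graphs-model (proj i) xs       = graphs (proj i) refl proj⇓
  graphs-model (comp {m = m} f gs) = &⁺ {A = comp-axiom f gs} {axioms f & axioms* gs} comp-model
    (&⁺ {A = axioms f} {axioms* gs} (graphs-model f) (graphs-model* gs))
    where
    comp-model : Graphs ⊩ comp-axiom f gs
    comp-model (z ∷ v) = Premises⁺ gs (take m v) λ gys fz →
      graphs (comp f gs) refl (comp⇓ (λ i → graphs⁻ (lookup gs i) (gys i)) (graphs⁻ f fz))
  graphs-model (prec f g) = &⁺ {A = prec-zero-axiom f g} {prec-suc-axiom f g & axioms f & axioms g}
    (λ { (y ∷ xs) fy → graphs (prec f g) refl (prec⇓-zero (graphs⁻ f fy)) })
    (&⁺ {A = prec-suc-axiom f g} {axioms f & axioms g}
      (λ { (z ∷ y ∷ k ∷ xs) ry gz → graphs (prec f g) refl (prec⇓-suc (graphs⁻ (prec f g) ry) (graphs⁻ g gz)) })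
      (&⁺ {A = axioms f} {axioms g} (graphs-model f) (graphs-model g)))
  graphs-model (mu f) = &⁺ {A = positive-zero-axiom f} {positive-suc-axiom f & mu-axiom f & axioms f}
    (λ xs → positives f refl λ _ ())
    (&⁺ {A = positive-suc-axiom f} {mu-axiom f & axioms f}
      (λ { (v ∷ k ∷ xs) below fv → positives f refl λ j j<1+k →
             [ positives⁻ f below j , (λ { refl → v , graphs⁻ f fv }) ] (m≤n⇒m<n∨m≡n (s≤s⁻¹ j<1+k)) })
      (&⁺ {A = mu-axiom f} {axioms f}
        (λ { (k ∷ xs) below f0 → graphs (mu f) refl (mu⇓ (positives⁻ f below) (graphs⁻ f f0)) })
        (graphs-model f)))

  graphs-model* : ∀ (gs : Vec (Rec n) m) → Graphs ⊩ axioms* gs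
  graphs-model* []       = graphs-model zero
  graphs-model* (g ∷ gs) = &⁺ {A = axioms g} {axioms* gs} (graphs-model g) (graphs-model* gs)

-- The reduction

numeral : ℕ → Term n
numeral zero    = `0
numeral (suc x) = `1 `+ numeral x

⟦numeral⟧ : ∀ x (ρ : Vec ℕ n) → ⟦ numeral x ⟧ ρ ≡ x
⟦numeral⟧ zero    ρ = refl
⟦numeral⟧ (suc x) ρ = cong suc (⟦numeral⟧ x ρ)

module Reduction (lem : ExcludedMiddle 0ℓ) (c : Rec 1) where

  private
    N : ℕ
    N = arity (axioms c)

    theory : Formula (suc N)
    -- Variable 0 is reserved for the output in `divergence`.
    theory = instance-at (axioms c) (tabulate (λ i → var (suc i)))

    divergence : ℕ → Formula (suc N)
    divergence x = `¬ pred (graph c) (var zero ∷ numeral x ∷ [])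

    sentence : ℕ → Sentence
    sentence x = closure (suc N) (theory `∧ divergence x)

    sentence-universal : ∀ x → Universal (sentence x)
    sentence-universal x = closure-universal (suc N) (matrix (qf-∧ (qf (axioms c) _) (qf-¬ qf-pred)))

    theory-⊨ : ∀ {I} y ρ → (I , y ∷ ρ ⊨ theory) ≡ Meaning (axioms c) I ρ
    theory-⊨ {I} y ρ = trans (meaning (axioms c) I (y ∷ ρ) _)
      (cong (Meaning (axioms c) I) (trans (sym (tabulate-∘ _ _)) (tabulate∘lookup ρ)))

    divergence-⊨ : ∀ I x y ρ → (I , y ∷ ρ ⊨ divergence x) ≡ (¬ I 2 (graph c) (y ∷ x ∷ []))
    divergence-⊨ I x y ρ = cong (λ x → ¬ I 2 (graph c) (y ∷ x ∷ [])) (⟦numeral⟧ x (y ∷ ρ))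

  halts⇒unsatisfiable : ∀ {x} → ∃[ y ] c [ x ∷ [] ]⇓ y → Unsatisfiable (sentence x)
  halts⇒unsatisfiable {x} (y , c⇓y) (I , ⊨x) =
    subst id (divergence-⊨ I x y (replicate N 0)) (proj₂ (instances y (replicate N 0)))
      (axioms-complete c (λ ρ → subst id (theory-⊨ 0 ρ) (proj₁ (instances 0 ρ))) c⇓y)
    where
    instances : ∀ y ρ → I , y ∷ ρ ⊨ theory `∧ divergence x
    instances y ρ = Equivalence.to (closure-⊨ (suc N)) ⊨x (y ∷ ρ)

  unsatisfiable⇒halts : ∀ {x} → Unsatisfiable (sentence x) → ∃[ y ] c [ x ∷ [] ]⇓ y
  unsatisfiable⇒halts {x} unsatisfiable with lem {∃[ y ] c [ x ∷ [] ]⇓ y}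
  ... | yes halts = halts
  ... | no ¬halts = contradiction (Graphs , Equivalence.from (closure-⊨ (suc N)) model) unsatisfiable
    where
    model : ∀ ρ → Graphs , ρ ⊨ theory `∧ divergence x
    model (y ∷ ρ) = subst id (sym (theory-⊨ y ρ)) (graphs-model c ρ) ,
                    subst id (sym (divergence-⊨ Graphs x y ρ)) (λ c↓ → ¬halts (y , graphs⁻ c c↓))

  reduction : ∃[ f ] (Computable f × (∀ x → (∃[ y ] c [ x ∷ [] ]⇓ y) ⇔ UnsatisfiableUniversal (f x)))
  reduction = (λ x → ⌜ sentence x ⌝) , (code sentence-recursive , λ x → computes sentence-recursive (x ∷ [])) ,
    λ x → mk⇔ (λ halts → sentence x , refl , sentence-universal x , halts⇒unsatisfiable halts)
              (λ (φ , eq , _ , unsatisfiable) → unsatisfiable⇒halts {x}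
                -- Membership only provides some unsatisfiable φ with the same code; injectivity
                -- identifies it with the sentence constructed.
                (subst Unsatisfiable (sym (⌜⌝-injective (sentence x) φ eq)) unsatisfiable))
    where
    numeral-recursive : Recursive 1 (λ xs → ⌜ numeral {suc N} (lookup xs 0F) ⌝ₜ)
    numeral-recursive = recursion (const ⟨ 1 , 0 ⟩)
      (app ⟨⟩-recursive (const 3 ∷ app ⟨⟩-recursive (const ⟨ 2 , 0 ⟩ ∷ arg 1F ∷ []) ∷ []))
      (λ _ → refl) (λ _ _ → refl)

    matrix-recursive : Recursive 1 (λ xs → ⌜ theory `∧ divergence (lookup xs 0F) ⌝)
    -- Only the numeral depends on x; all other parts of the code are constants.
    matrix-recursive = app ⟨⟩-recursive (const 5 ∷ app ⟨⟩-recursive (const ⌜ theory ⌝ ∷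
      app ⟨⟩-recursive (const 4 ∷ app ⟨⟩-recursive (const 3 ∷ app ⟨⟩-recursive (const (graph c) ∷
        app suc-recursive (app ⟨⟩-recursive (const ⟨ 0 , 0 ⟩ ∷
          app suc-recursive (app ⟨⟩-recursive (numeral-recursive ∷ const 0 ∷ []) ∷ []) ∷ []) ∷ [])
        ∷ []) ∷ []) ∷ []) ∷ []) ∷ [])

    sentence-recursive : Recursive 1 (λ xs → ⌜ sentence (lookup xs 0F) ⌝)
    sentence-recursive = respects (λ xs → sym (⌜closure⌝ (suc N) (theory `∧ divergence (lookup xs 0F))))
      (app quantify-recursive (const (suc N) ∷ matrix-recursive ∷ []))

hard : ExcludedMiddle 0ℓ → Σ⁰₁-Hard UnsatisfiableUniversal
hard lem A (c , A⇔) = let f , f-recursive , f-reduces = Reduction.reduction lem c in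
  f , f-recursive , λ x → mk⇔
    (λ Ax → Equivalence.to (f-reduces x) (Equivalence.to (A⇔ x) Ax))
    (λ unsat → Equivalence.from (A⇔ x) (Equivalence.from (f-reduces x) unsat))

theorem10 : ExcludedMiddle 0ℓ → Σ⁰₁-Complete UnsatisfiableUniversal
theorem10 lem = recursively-enumerable lem , hard lem
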